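{- Let $p,q\ge 1$ be integers and fix $0<c<1$. Let $m=cn$ and let $\pi$ be chosen uniformly at random from $\mathrm{PF}(m,n)$. Then, as $n\to\infty$, $$\mathbb E(\pi_1^p)=\frac{n^p}{p+1}\left(1+\frac1n\left(\frac{p+1}{2}-\frac{cp}{1-c}\right)+O\left(\frac1{n^2}\right)\right)$$ and $$\mathbb E(\pi_1^p\pi_2^q)=\frac{n^{p+q}}{(p+1)(q+1)}\left(1+\frac1n\left(\frac{p+q+2}{2}-\frac{c(p+q)}{1-c}\right)+O\left(\frac1{n^2}\right)\right).$$
   Context: Write $[n]=\{1,\dots,n\}$. For integers $0\le m\le n$, $\mathrm{PF}(m,n)$ denotes the set of parking functions with $m$ cars and $n$ spots: sequences $(\pi_1,\dots,\pi_m)\in[n]^m$ such that, when cars $1,\dots,m$ enter in order a one-way street with spots $1,\dots,n$ and car $i$ parks in spot $\pi_i$ if it is free and otherwise in the first free spot after $\pi_i$, all cars park. Equivalently, the non-decreasing rearrangement $(\lambda_1,\dots,\lambda_m)$ satisfies $\lambda_i\le n-m+i$ for all $i$. The limit $n\to\infty$ is along integers $n$ with $cn$ an integer; $c,p,q$ are fixed and the $O$-constants may depend on them. -}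

module Defs where

open import Data.Fin using (Fin; zero; suc; toℕ; fromℕ<)
open import Data.Fin.Subset using (Subset; inside; outside; ⊥)
open import Data.Integer using (+_)
open import Data.List using (List; []; _∷_; length; map; foldr; filter; allFin; cartesianProductWith)
open import Data.Maybe as Maybe using (Maybe; just; nothing; Is-just; _>>=_)
open import Data.Maybe.Relation.Unary.Any using (dec)
open import Data.Nat as ℕ using (ℕ; zero; suc)
open import Data.Rational using (ℚ; NonZero; 0ℚ; 1ℚ; _+_; _-_; -_; _*_; _/_; _<_; >-nonZero)
open import Data.Rational.Properties using (+-monoˡ-<; +-inverseʳ)
open import Data.Unit using (tt)
open import Data.Vec as Vec using (Vec; []; _∷_; lookup)
open import Relation.Binary.PropositionalEquality using (subst)
open import Relation.Nullary using (Dec; yes)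

-- A street with n spots is represented by the subset of its occupied spots.
-- The n spots are indexed by Fin n, so that index i stands for spot i + 1.

fillFirstFree : ∀ {n} → Subset n → Maybe (Subset n)
fillFirstFree []            = nothing
fillFirstFree (outside ∷ s) = just (inside ∷ s)
fillFirstFree (inside  ∷ s) = Maybe.map (inside ∷_) (fillFirstFree s)

-- One car with preference i takes the first free spot at or after i;
-- the result is nothing if there is none.
parkCar : ∀ {n} → Fin n → Subset n → Maybe (Subset n)
parkCar zero    s       = fillFirstFree s
parkCar (suc i) (b ∷ s) = Maybe.map (b ∷_) (parkCar i s)

-- Cars enter in the order of the vector of preferences.
parkCars : ∀ {m n} → Vec (Fin n) m → Subset n → Maybe (Subset n)
parkCars []      s = just s
parkCars (i ∷ π) s = parkCar i s >>= parkCars π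

IsParking : ∀ {m n} → Vec (Fin n) m → Set
IsParking π = Is-just (parkCars π ⊥)

isParking? : ∀ {m n} (π : Vec (Fin n) m) → Dec (IsParking π)
isParking? π = dec (λ _ → yes tt) (parkCars π ⊥)

-- Every element of [n]^m, exactly once.
preferences : ∀ m n → List (Vec (Fin n) m)
preferences zero    n = [] ∷ []
preferences (suc m) n = cartesianProductWith _∷_ (allFin n) (preferences m n)

PF : ∀ m n → List (Vec (Fin n) m)
PF m n = filter isParking? (preferences m n)

-- The preference, as a number in {1,…,n}, of the car with 0-based index i:
-- π₁ is pref 0 and π₂ is pref 1.
pref : ∀ {m n} (i : ℕ) → .(i ℕ.< m) → Vec (Fin n) m → ℕ
pref i i<m π = suc (toℕ (lookup π (fromℕ< i<m)))

fromℕ : ℕ → ℚ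
fromℕ k = + k / 1

-- Expectation of X under the uniform distribution on the entries of a list.
-- The value on the empty list is a convention; PF m n is non-empty for m ≤ n.
𝔼 : ∀ {a} {A : Set a} → List A → (A → ℚ) → ℚ
𝔼 []           X = 0ℚ
𝔼 xs@(_ ∷ _) X = foldr _+_ 0ℚ (map X xs) * (+ 1 / length xs)

1-c≢0 : ∀ {c} → c < 1ℚ → NonZero (1ℚ - c)
1-c≢0 {c} c<1 = >-nonZero (subst (_< 1ℚ - c) (+-inverseʳ c) (+-monoˡ-< (- c) c<1))

{-# OPTIONS --safe #-}
module Submission where

-- Let σ be the preferences of all cars but the first one (or the first two).
-- The order of the cars does not matter, so the first car may take any
-- preference up to the last free spot f that σ leaves, and E(π₁ᵖ) is the
-- ratio of the sums of 1ᵖ + ⋯ + fᵖ and of f over the σ that park.  Two cars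
-- may choose independently up to f, except for a deficit that is of lower
-- order.  With N = n + 1, ℓ = N − f and M cars in σ, cutting off the first
-- spot does not change ℓ, so any sum of φ(ℓ) is a binomial transform of the same
-- sum for n − 1 spots and is determined by the full streets M = n.  This gives
--   Σ 1 = Nᴹ − M Nᴹ⁻¹,  Σ ℓ = Nᴹ,  Σ ℓ² = Σₖ (k + 1) M (M − 1) ⋯ (M − k + 1) Nᴹ⁻ᵏ,
-- and the total deficit equals Σ ℓ².  As M ≈ c n, the last sum is O(Nᴹ), so an
-- expansion of the power sums to first order in ℓ suffices.

-- With exponential generating functions in t, where t marks the cars, cutting off the first spot
-- turns into multiplication by eᵗ. The three sums belong to (1 - t) e^(Nt), e^(Nt) and e^(Nt) / (1
-- - t)², so passing from N to N + 1 keeps each shape. These closed forms fail for overfull streets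
-- in general, so each induction is anchored at the boundary of its range.
--
-- The correction terms can be read off the moments. The mean of ℓ is N / (N - M), which tends to 1
-- / (1 - c), so on average about c / (1 - c) spots lie beyond the last free one. To first order
-- they scale Σ fᵖ⁺¹ by 1 - (p + 1) c / ((1 - c) n) and the normalising Σ f by 1 - c / ((1 - c) n);
-- the quotient leaves - c p / (1 - c). The term (p + 1) / 2 comes from the trapezoidal correction
-- fᵖ / 2 to fᵖ⁺¹ / (p + 1). For two cars both effects add.
--
-- Up to the bounds for power sums everything stays in ℕ: identities are stated additively, and
-- error terms are defined by recursions with nonnegative terms, which makes their signs automatic.

module Counting where

  open import Defs using (fillFirstFree; parkCar; parkCars; isParking?; preferences; PF)
  open import Data.Bool using (Bool; true; false; _∧_; if_then_else_)
  open import Data.Fin using (Fin; zero; suc; toℕ)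
  open import Data.Fin.Properties using (toℕ<n)
  open import Data.Fin.Subset using (Subset; inside; outside; ⊥)
  open import Data.List using (List; []; _∷_; _++_; length; map; filter; tabulate; cartesianProductWith)
  open import Data.List.Properties using (map-++; map-∘; map-cong)
  open import Data.Maybe using (just; nothing; is-just)
  open import Data.Nat
  open import Data.Nat.ListAction using () renaming (sum to sumᴸ)
  open import Data.Nat.ListAction.Properties using (sum-++)
  open import Data.Nat.Properties
  open import Data.Nat.Tactic.RingSolver using (solve-∀)
  open import Data.Sum using (inj₁; inj₂)
  open import Data.Vec using (Vec; []; _∷_; toList)
  open import Function using (_∘_; id)
  open import Relation.Binary.PropositionalEquality
  open import Relation.Nullary using (does; Dec)
  open import Algebra.Properties.Semiring.Sum +-*-semiring using (sum; sum-cong-≗; ∑-distrib-+; *-distribˡ-sum)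

  -- The last free spot

  ≤⇒<ᵇ-suc : ∀ {m n} → m ≤ n → (m <ᵇ suc n) ≡ true
  ≤⇒<ᵇ-suc z≤n       = refl
  ≤⇒<ᵇ-suc (s≤s m≤n) = ≤⇒<ᵇ-suc m≤n

  ≤⇒≮ᵇ : ∀ {m n} → n ≤ m → (m <ᵇ n) ≡ false
  ≤⇒≮ᵇ z≤n       = refl
  ≤⇒≮ᵇ (s≤s m≤n) = ≤⇒≮ᵇ m≤n

  dropFirst : ∀ {n} → List (Fin (suc n)) → List (Fin n)
  dropFirst []          = []
  dropFirst (zero  ∷ σ) = dropFirst σ
  dropFirst (suc i ∷ σ) = i ∷ dropFirst σ

  -- The criterion for parking: for every k ≤ n, at most k cars prefer one of
  -- the last k spots.
  fits : ∀ {n} → List (Fin n) → Bool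
  fits {zero}  _ = true
  fits {suc n} σ = (length σ <ᵇ suc (suc n)) ∧ fits (dropFirst σ)

  -- The number of the last free spot after σ has parked, or 0 if there is none.
  lastFree : ∀ {n} → List (Fin n) → ℕ
  lastFree {zero}  _ = 0
  lastFree {suc n} σ = if length σ <ᵇ suc n then suc (lastFree (dropFirst σ)) else 0

  lastFree≤n : ∀ {n} (σ : List (Fin n)) → lastFree σ ≤ n
  lastFree≤n {zero}  σ = z≤n
  lastFree≤n {suc n} σ with length σ <ᵇ suc n
  ... | true  = s≤s (lastFree≤n (dropFirst σ))
  ... | false = z≤n

  <ᵇ-suc : ∀ m n → (m <ᵇ n) ≡ true → (m <ᵇ suc n) ≡ true
  <ᵇ-suc zero    n       _  = refl
  <ᵇ-suc (suc m) (suc n) eq = <ᵇ-suc m n eq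

  -- A new car raises the count of exactly those suffixes that start at or before its preference.
  -- `lastFree σ` is the start of the first suffix without slack, so all raised suffixes have room
  -- exactly when `toℕ i` lies below it.
  fits-∷ : ∀ {n} (i : Fin n) σ → fits (i ∷ σ) ≡ fits σ ∧ (toℕ i <ᵇ lastFree σ)
  fits-∷ {suc n} i σ with length σ <ᵇ suc n in eq
  fits-∷ {suc n} zero σ    | true rewrite <ᵇ-suc (length σ) (suc n) eq with fits (dropFirst σ)
  ... | true  = refl
  ... | false = refl
  fits-∷ {suc n} (suc i) σ | true rewrite <ᵇ-suc (length σ) (suc n) eq = fits-∷ i (dropFirst σ)
  fits-∷ {suc n} i σ       | false with (length σ <ᵇ suc (suc n)) ∧ fits (dropFirst σ)
  ... | true  = refl
  ... | false = refl

  lastFree-∷ : ∀ {n} (i : Fin n) σ → lastFree (i ∷ σ) ≤ lastFree σ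
  lastFree-∷ {suc n} i σ with length σ <ᵇ n in eq
  ... | false = z≤n
  ... | true rewrite <ᵇ-suc (length σ) n eq with i
  ...   | zero  = ≤-refl
  ...   | suc j = s≤s (lastFree-∷ j (dropFirst σ))

  lastFree-full : ∀ {n} (σ : List (Fin n)) → length σ ≡ n → lastFree σ ≡ 0
  lastFree-full {zero}  σ _  = refl
  lastFree-full {suc n} σ eq rewrite eq | ≤⇒≮ᵇ (≤-refl {n}) = refl

  -- Sums over tuples and the binomial transform

  sumTuples : ∀ {n} (m : ℕ) → (List (Fin n) → ℕ) → ℕ
  sumTuples zero    g = g []
  sumTuples (suc m) g = sum (λ i → sumTuples m (g ∘ (i ∷_)))

  sumTuples-cong : ∀ {n} m {g h : List (Fin n) → ℕ} →
    (∀ σ → length σ ≡ m → g σ ≡ h σ) → sumTuples m g ≡ sumTuples m h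
  sumTuples-cong zero    eq = eq [] refl
  sumTuples-cong (suc m) eq = sum-cong-≗ (λ i → sumTuples-cong m (λ σ l → eq (i ∷ σ) (cong suc l)))

  sumTuples-+ : ∀ {n} m (g h : List (Fin n) → ℕ) →
    sumTuples m (λ σ → g σ + h σ) ≡ sumTuples m g + sumTuples m h
  sumTuples-+ zero    g h = refl
  sumTuples-+ {n} (suc m) g h = trans (sum-cong-≗ (λ i → sumTuples-+ m (g ∘ (i ∷_)) (h ∘ (i ∷_))))
    (∑-distrib-+ {n} (λ i → sumTuples m (g ∘ (i ∷_))) (λ i → sumTuples m (h ∘ (i ∷_))))

  sumTuples-* : ∀ {n} m k (g : List (Fin n) → ℕ) →
    sumTuples m (λ σ → k * g σ) ≡ k * sumTuples m g
  sumTuples-* zero    k g = refl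
  sumTuples-* {n} (suc m) k g = trans (sum-cong-≗ (λ i → sumTuples-* m k (g ∘ (i ∷_))))
    (sym (*-distribˡ-sum {n} k (λ i → sumTuples m (g ∘ (i ∷_)))))

  sum-mono : ∀ {n} {g h : Fin n → ℕ} → (∀ i → g i ≤ h i) → sum g ≤ sum h
  sum-mono {zero}  le = z≤n
  sum-mono {suc n} le = +-mono-≤ (le zero) (sum-mono (le ∘ suc))

  sumTuples-0 : ∀ {n} m {g : List (Fin n) → ℕ} → (∀ σ → length σ ≡ m → g σ ≡ 0) → sumTuples m g ≡ 0
  sumTuples-0 m eq = trans (sumTuples-cong m {h = λ _ → 0 * 0} eq) (sumTuples-* m 0 (λ _ → 0))

  sum-sumTuples : ∀ {n k} m (g : Fin k → List (Fin n) → ℕ) →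
    sum (λ i → sumTuples m (g i)) ≡ sumTuples m (λ σ → sum (λ i → g i σ))
  sum-sumTuples {k = zero}  m g = sym (sumTuples-0 m (λ _ _ → refl))
  sum-sumTuples {k = suc k} m g =
    trans (cong (sumTuples m (g zero) +_) (sum-sumTuples m (g ∘ suc)))
          (sym (sumTuples-+ m (g zero) _))

  -- binomial m f = Σⱼ (m choose j) f j.
  binomial : ℕ → (ℕ → ℕ) → ℕ
  binomial zero    f = f 0
  binomial (suc m) f = binomial m f + binomial m (f ∘ suc)

  binomial-cong : ∀ m {f g : ℕ → ℕ} → (∀ {j} → j ≤ m → f j ≡ g j) → binomial m f ≡ binomial m g
  binomial-cong zero    eq = eq z≤n
  binomial-cong (suc m) eq = cong₂ _+_ (binomial-cong m (eq ∘ m≤n⇒m≤1+n)) (binomial-cong m (eq ∘ s≤s))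

  interchange : ∀ a b c d → (a + b) + (c + d) ≡ (a + c) + (b + d)
  interchange = solve-∀

  binomial-+ : ∀ m (f g : ℕ → ℕ) → binomial m (λ j → f j + g j) ≡ binomial m f + binomial m g
  binomial-+ zero    f g = refl
  binomial-+ (suc m) f g =
    trans (cong₂ _+_ (binomial-+ m f g) (binomial-+ m (f ∘ suc) (g ∘ suc)))
          (interchange (binomial m f) _ _ _)

  binomial-* : ∀ m k (f : ℕ → ℕ) → binomial m (λ j → k * f j) ≡ k * binomial m f
  binomial-* zero    k f = refl
  binomial-* (suc m) k f =
    trans (cong₂ _+_ (binomial-* m k f) (binomial-* m k (f ∘ suc))) (sym (*-distribˡ-+ k _ _))

  binomial-0 : ∀ m → binomial m (λ _ → 0) ≡ 0
  binomial-0 zero    = refl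
  binomial-0 (suc m) = cong₂ _+_ (binomial-0 m) (binomial-0 m)

  sum-binomial : ∀ {k} m (f : Fin k → ℕ → ℕ) →
    sum (λ i → binomial m (f i)) ≡ binomial m (λ j → sum (λ i → f i j))
  sum-binomial {zero}  m f = sym (binomial-0 m)
  sum-binomial {suc k} m f =
    trans (cong (binomial m (f zero) +_) (sum-binomial m (f ∘ suc))) (sym (binomial-+ m (f zero) _))

  -- A tuple over Fin (suc n) is a tuple over Fin n together with the positions of its entries.
  sumTuples-dropFirst : ∀ {n} m (g : List (Fin n) → ℕ) →
    sumTuples m (g ∘ dropFirst) ≡ binomial m (λ j → sumTuples j g)
  sumTuples-dropFirst zero    g = refl
  sumTuples-dropFirst (suc m) g = cong₂ _+_ (sumTuples-dropFirst m g)
    (trans (sum-cong-≗ (λ i → sumTuples-dropFirst m (g ∘ (i ∷_))))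
           (sum-binomial m (λ i j → sumTuples j (g ∘ (i ∷_)))))

  sumFits : ∀ {n} m → (List (Fin n) → ℕ) → ℕ
  sumFits m g = sumTuples m (λ σ → if fits σ then g σ else 0)

  sumFits-cong : ∀ {n} m {g h : List (Fin n) → ℕ} →
    (∀ σ → length σ ≡ m → g σ ≡ h σ) → sumFits m g ≡ sumFits m h
  sumFits-cong m eq = sumTuples-cong m (λ σ l → cong (if fits σ then_else 0) (eq σ l))

  sumFits-+ : ∀ {n} m (g h : List (Fin n) → ℕ) →
    sumFits m (λ σ → g σ + h σ) ≡ sumFits m g + sumFits m h
  sumFits-+ m g h = trans (sumTuples-cong m (λ σ _ → lemma (fits σ) (g σ) (h σ))) (sumTuples-+ m _ _)
    where
    lemma : ∀ b x y → (if b then x + y else 0) ≡ (if b then x else 0) + (if b then y else 0)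
    lemma true  x y = refl
    lemma false x y = refl

  sumFits-* : ∀ {n} m k (g : List (Fin n) → ℕ) → sumFits m (λ σ → k * g σ) ≡ k * sumFits m g
  sumFits-* m k g = trans (sumTuples-cong m (λ σ _ → lemma (fits σ) (g σ))) (sumTuples-* m k _)
    where
    lemma : ∀ b x → (if b then k * x else 0) ≡ k * (if b then x else 0)
    lemma true  x = refl
    lemma false x = sym (*-zeroʳ k)

  -- Under `m ≤ suc n` the test on the whole street always succeeds, so the summand depends on
  -- `dropFirst σ` alone, and the binomial coefficients count the fibres of `dropFirst`.
  sumFits-suc : ∀ {n} m (g : List (Fin (suc n)) → ℕ) (h : List (Fin n) → ℕ) → m ≤ suc n →
    (∀ σ → length σ ≡ m → g σ ≡ h (dropFirst σ)) →
    sumFits m g ≡ binomial m (λ j → sumFits j h)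
  sumFits-suc {n} m g h m≤1+n eq =
    trans (sumTuples-cong m lemma) (sumTuples-dropFirst m (λ σ → if fits σ then h σ else 0))
    where
    lemma : ∀ σ → length σ ≡ m →
      (if fits σ then g σ else 0) ≡ (if fits (dropFirst σ) then h (dropFirst σ) else 0)
    lemma σ l rewrite eq σ l | l | ≤⇒<ᵇ-suc m≤1+n = refl

  fits-overfull : ∀ {n} (σ : List (Fin n)) → n < length σ → fits σ ≡ false
  fits-overfull {zero}  (() ∷ σ) lt
  fits-overfull {suc n} σ        lt rewrite ≤⇒≮ᵇ lt = refl

  countFits : ℕ → ℕ → ℕ
  countFits n m = sumFits {n} m (λ _ → 1)

  countFits-overfull : ∀ n {m} → n < m → countFits n m ≡ 0
  countFits-overfull n {m} lt =
    sumTuples-0 m (λ σ l → cong (if_then 1 else 0) (fits-overfull σ (subst (n <_) (sym l) lt)))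

  -- Exponential generating functions and resolvents

  -- Multiplication by x in terms of exponential generating functions.
  shift : (ℕ → ℕ) → ℕ → ℕ
  shift f zero    = 0
  shift f (suc m) = suc m * f m

  -- The binomial transform is multiplication by eˣ, which commutes with multiplication by x; hence
  -- it also commutes with the resolvent 1 / (1 - x).
  binomial-shift : ∀ m f → binomial m (shift f) ≡ shift (λ j → binomial j f) m
  binomial-shift zero          f = refl
  binomial-shift (suc zero)    f = refl
  binomial-shift (suc (suc m)) f = begin
    binomial (suc m) (shift f) + binomial (suc m) (λ j → suc j * f j)
      ≡⟨ cong₂ _+_ (binomial-shift (suc m) f) (binomial-+ (suc m) f (λ j → j * f j)) ⟩
    suc m * binomial m f + (binomial (suc m) f + binomial (suc m) (λ j → j * f j))
      ≡⟨ cong (λ x → suc m * binomial m f + (binomial (suc m) f + x))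
           (trans (binomial-cong (suc m) (λ {j} _ → lemma j)) (binomial-shift (suc m) (f ∘ suc))) ⟩
    suc m * binomial m f + (binomial (suc m) f + suc m * binomial m (f ∘ suc))
      ≡⟨ rearrange (suc m) (binomial m f) (binomial m (f ∘ suc)) ⟩
    suc (suc m) * binomial (suc m) f ∎
    where
    open ≡-Reasoning
    lemma : ∀ j → j * f j ≡ shift (f ∘ suc) j
    lemma zero    = refl
    lemma (suc j) = refl
    rearrange : ∀ k a b → k * a + ((a + b) + k * b) ≡ suc k * (a + b)
    rearrange = solve-∀

  -- resolvent a = Σₖ shiftᵏ a
  resolvent : (ℕ → ℕ) → ℕ → ℕ
  resolvent a zero    = a 0
  resolvent a (suc m) = a (suc m) + suc m * resolvent a m

  resolvent-unfold : ∀ a m → resolvent a m ≡ a m + shift (resolvent a) m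
  resolvent-unfold a zero    = sym (+-identityʳ _)
  resolvent-unfold a (suc m) = refl

  binomial-resolvent : ∀ m a → binomial m (resolvent a) ≡ resolvent (λ j → binomial j a) m
  binomial-resolvent zero    a = refl
  binomial-resolvent (suc m) a = begin
    binomial (suc m) (resolvent a)
      ≡⟨ binomial-cong (suc m) (λ {j} _ → resolvent-unfold a j) ⟩
    binomial (suc m) (λ j → a j + shift (resolvent a) j)
      ≡⟨ binomial-+ (suc m) a (shift (resolvent a)) ⟩
    binomial (suc m) a + binomial (suc m) (shift (resolvent a))
      ≡⟨ cong (binomial (suc m) a +_) (binomial-shift (suc m) (resolvent a)) ⟩
    binomial (suc m) a + suc m * binomial m (resolvent a)
      ≡⟨ cong (λ x → binomial (suc m) a + suc m * x) (binomial-resolvent m a) ⟩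
    binomial (suc m) a + suc m * resolvent (λ j → binomial j a) m ∎
    where open ≡-Reasoning

  binomial-^ : ∀ m x → binomial m (x ^_) ≡ suc x ^ m
  binomial-^ zero    x = refl
  binomial-^ (suc m) x = cong₂ _+_ (binomial-^ m x)
    (trans (binomial-* m x (x ^_)) (cong (x *_) (binomial-^ m x)))

  resolvent-cong : ∀ {a b} → (∀ m → a m ≡ b m) → ∀ m → resolvent a m ≡ resolvent b m
  resolvent-cong eq zero    = eq 0
  resolvent-cong eq (suc m) = cong₂ (λ x y → x + suc m * y) (eq (suc m)) (resolvent-cong eq m)

  -- doubleResolvent x m = Σₖ (k + 1) m (m − 1) ⋯ (m − k + 1) x ^ (m − k)
  doubleResolvent : ℕ → ℕ → ℕ
  doubleResolvent x = resolvent (resolvent (x ^_))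

  -- The generating function of `doubleResolvent x` is e^(xt) / (1 - t)², and a further factor eᵗ
  -- raises x by one.
  binomial-doubleResolvent : ∀ m x → binomial m (doubleResolvent x) ≡ doubleResolvent (suc x) m
  binomial-doubleResolvent m x = trans (binomial-resolvent m _) (resolvent-cong
    (λ j → trans (binomial-resolvent j (x ^_)) (resolvent-cong (λ i → binomial-^ i x) j)) m)

  -- The k-th summand on the left carries the factor j + k + 1 = x - (m - k), so it is the
  -- difference of consecutive terms of m (m - 1) ⋯ (m - k + 1) x ^ (m - k + 1); only the term for k
  -- = 0 survives.
  doubleResolvent-telescope : ∀ m j {x} → x ≡ suc (m + j) →
    j * resolvent (x ^_) m + doubleResolvent x m ≡ x ^ suc m
  doubleResolvent-telescope zero j refl = lemma j
    where
    lemma : ∀ j → j * 1 + 1 ≡ suc j * 1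
    lemma = solve-∀
  doubleResolvent-telescope (suc m) j {x} refl = begin
    j * (x ^ suc m + suc m * v) + ((x ^ suc m + suc m * v) + suc m * u) ≡⟨ regroup j (suc m) (x ^ suc m) v u ⟩
    suc j * x ^ suc m + suc m * (suc j * v + u)
      ≡⟨ cong (λ y → suc j * x ^ suc m + suc m * y)
           (doubleResolvent-telescope m (suc j) (cong suc (sym (+-suc m j)))) ⟩
    suc j * x ^ suc m + suc m * x ^ suc m ≡⟨ collect j m (x ^ suc m) ⟩
    x * x ^ suc m ∎
    where
    open ≡-Reasoning
    v = resolvent (x ^_) m
    u = doubleResolvent x m
    regroup : ∀ j k w v u → j * (w + k * v) + ((w + k * v) + k * u) ≡ suc j * w + k * (suc j * v + u)
    regroup = solve-∀
    collect : ∀ j m w → suc j * w + suc m * w ≡ suc (suc m + j) * w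
    collect = solve-∀

  doubleResolvent-boundary : ∀ n → doubleResolvent (suc n) n ≡ suc n ^ suc n
  doubleResolvent-boundary n = doubleResolvent-telescope n 0 (cong suc (sym (+-identityʳ n)))

  -- A geometric series: each further term gains a factor of at most m / x ≤ 1 - d / x, so the sum
  -- is at most x / d times the leading bound. In the induction this is the inequality d + (j + 1) ≤
  -- x.
  resolvent-bound : ∀ a A x d m → m + d ≤ x → (∀ {j} → j ≤ m → a j ≤ A * x ^ j) →
    ∀ {j} → j ≤ m → d * resolvent a j ≤ A * x ^ suc j
  resolvent-bound a A x d m le bound {zero} _ = begin
    d * a 0       ≤⟨ *-mono-≤ (≤-trans (m≤n+m d m) le) (bound z≤n) ⟩
    x * (A * 1)   ≡⟨ lemma x A ⟩
    A * (x * 1)   ∎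
    where
    open ≤-Reasoning
    lemma : ∀ x A → x * (A * 1) ≡ A * (x * 1)
    lemma = solve-∀
  resolvent-bound a A x d m le bound {suc j} j<m = begin
    d * (a (suc j) + suc j * resolvent a j)
      ≡⟨ expand d (a (suc j)) (suc j) (resolvent a j) ⟩
    d * a (suc j) + suc j * (d * resolvent a j)
      ≤⟨ +-mono-≤ (*-monoʳ-≤ d (bound j<m))
           (*-monoʳ-≤ (suc j) (resolvent-bound a A x d m le bound (<⇒≤ j<m))) ⟩
    d * (A * x ^ suc j) + suc j * (A * x ^ suc j)
      ≡⟨ sym (*-distribʳ-+ (A * x ^ suc j) d (suc j)) ⟩
    (d + suc j) * (A * x ^ suc j)
      ≤⟨ *-monoˡ-≤ (A * x ^ suc j)
           (≤-trans (≤-reflexive (+-comm d (suc j))) (≤-trans (+-monoˡ-≤ d j<m) le)) ⟩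
    x * (A * x ^ suc j)
      ≡⟨ swap x A (x ^ suc j) ⟩
    A * (x * x ^ suc j) ∎
    where
    open ≤-Reasoning
    expand : ∀ d a k r → d * (a + k * r) ≡ d * a + k * (d * r)
    expand = solve-∀
    swap : ∀ x A w → x * (A * w) ≡ A * (x * w)
    swap = solve-∀

  doubleResolvent-bound : ∀ x d m → m + d ≤ x → d * d * doubleResolvent x m ≤ x * x * x ^ m
  doubleResolvent-bound x d m le = begin
    d * d * doubleResolvent x m    ≡⟨ *-assoc d d _ ⟩
    d * (d * doubleResolvent x m)  ≡⟨ cong (d *_) (resolvent-* d (resolvent (x ^_)) m) ⟩
    d * resolvent (λ j → d * resolvent (x ^_) j) m
      -- The inner bound `x ^ suc j` is read as `x * x ^ j`, so the outer resolvent is bounded with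
      -- `A = x`.
      ≤⟨ resolvent-bound _ x x d m le
          (λ {j} j≤m → ≤-trans (resolvent-bound (x ^_) 1 x d m le (λ {i} _ → ≤-reflexive (sym (*-identityˡ (x ^ i)))) j≤m)
                               (≤-reflexive (*-identityˡ (x ^ suc j)))) ≤-refl ⟩
    x * x ^ suc m ≡⟨ sym (*-assoc x x _) ⟩
    x * x * x ^ m ∎
    where
    open ≤-Reasoning
    resolvent-* : ∀ d a m → d * resolvent a m ≡ resolvent (λ j → d * a j) m
    resolvent-* d a zero    = refl
    resolvent-* d a (suc m) = trans (lemma d (a (suc m)) (suc m) (resolvent a m))
      (cong (λ y → d * a (suc m) + suc m * y) (resolvent-* d a m))
      where
      lemma : ∀ d a k r → d * (a + k * r) ≡ d * a + k * (d * r)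
      lemma = solve-∀

  -- The number of parking functions

  -- Both sides pass from n to n + 1 spots by the binomial transform. The range reaches one car
  -- beyond the full street because there the count is 0 and the other two terms agree at sight;
  -- only this boundary value is new at each step.
  countFits-formula : ∀ n {m} → m ≤ suc n → countFits n m + shift (suc n ^_) m ≡ suc n ^ m
  countFits-formula zero    {zero}        _ = refl
  countFits-formula zero    {suc zero}    _ = refl
  countFits-formula zero    {suc (suc _)} (s≤s ())
  countFits-formula (suc n) {m} m≤2+n with m≤n⇒m<n∨m≡n m≤2+n
  ... | inj₂ refl = cong (_+ (2 + n) * (2 + n) ^ suc n) (countFits-overfull (suc n) {2 + n} ≤-refl)
  ... | inj₁ (s≤s m≤1+n) = begin
    countFits (suc n) m + shift ((2 + n) ^_) m
      ≡⟨ cong₂ _+_ (sumFits-suc m _ (λ _ → 1) m≤1+n (λ _ _ → refl)) (shift-cong m) ⟩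
    binomial m (countFits n) + shift (λ j → binomial j (suc n ^_)) m
      ≡⟨ cong (binomial m (countFits n) +_) (sym (binomial-shift m (suc n ^_))) ⟩
    binomial m (countFits n) + binomial m (shift (suc n ^_))
      ≡⟨ sym (binomial-+ m (countFits n) (shift (suc n ^_))) ⟩
    binomial m (λ j → countFits n j + shift (suc n ^_) j)
      ≡⟨ binomial-cong m (λ j≤m → countFits-formula n (≤-trans j≤m m≤1+n)) ⟩
    binomial m (suc n ^_)
      ≡⟨ binomial-^ m (suc n) ⟩
    (2 + n) ^ m ∎
    where
    open ≡-Reasoning
    shift-cong : ∀ m → shift ((2 + n) ^_) m ≡ shift (λ j → binomial j (suc n ^_)) m
    shift-cong zero    = refl
    shift-cong (suc m) = cong (suc m *_) (sym (binomial-^ m (suc n)))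

  -- Moments of the gap

  -- One more than the number of spots after the last free one; with this shift
  -- the first two moments have simple formulas.
  gap : ∀ {n} → List (Fin n) → ℕ
  gap {n} σ = suc n ∸ lastFree σ

  sumGap : (ℕ → ℕ) → ℕ → ℕ → ℕ
  sumGap φ n m = sumFits {n} m (φ ∘ gap)

  sumGap-boundary : ∀ φ n → sumGap φ n n ≡ φ (suc n) * countFits n n
  sumGap-boundary φ n = trans
    (sumFits-cong n (λ σ l → trans (cong (λ t → φ (suc n ∸ t)) (lastFree-full σ l)) (sym (*-identityʳ _))))
    (sumFits-* n (φ (suc n)) (λ _ → 1))

  sumGap-suc : ∀ φ n {m} → m ≤ n → sumGap φ (suc n) m ≡ binomial m (sumGap φ n)
  sumGap-suc φ n {m} m≤n = sumFits-suc m (φ ∘ gap) (φ ∘ gap) (m≤n⇒m≤1+n m≤n) lemma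
    where
    lemma : (σ : List (Fin (suc n))) → length σ ≡ m → φ (gap σ) ≡ φ (gap (dropFirst σ))
    lemma σ l rewrite l | ≤⇒<ᵇ-suc m≤n = refl

  -- Cutting off the first spot does not change the gap, so the sums over the
  -- gap are determined by their values on full streets.
  sumGap-unique : ∀ φ (u : ℕ → ℕ → ℕ) → (∀ x m → binomial m (u x) ≡ u (suc x) m) →
    (∀ n → sumGap φ n n ≡ u (suc n) n) → ∀ n {m} → m ≤ n → sumGap φ n m ≡ u (suc n) m
  sumGap-unique φ u binomial-u boundary zero    z≤n   = boundary 0
  sumGap-unique φ u binomial-u boundary (suc n) {m} m≤1+n with m≤n⇒m<n∨m≡n m≤1+n
  ... | inj₂ refl = boundary (suc n)
  ... | inj₁ (s≤s m≤n) = trans (sumGap-suc φ n m≤n) (trans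
    (binomial-cong m (λ j≤m → sumGap-unique φ u binomial-u boundary n (≤-trans j≤m m≤n)))
    (binomial-u (suc n) m))

  -- This is Cayley's number (n + 1)ⁿ⁻¹; the factor `suc n` avoids the negative exponent at n = 0.
  countFits-full : ∀ n → suc n * countFits n n ≡ suc n ^ n
  countFits-full zero    = refl
  countFits-full (suc k) = cong (suc (suc k) *_)
    (+-cancelʳ-≡ (suc k * x ^ k) (countFits (suc k) (suc k)) (x ^ k)
      (countFits-formula (suc k) (n≤1+n (suc k))))
    where x = suc (suc k)

  sumGap-1 : ∀ n {m} → m ≤ n → sumGap (λ ℓ → ℓ) n m ≡ suc n ^ m
  sumGap-1 = sumGap-unique (λ ℓ → ℓ) _^_ (λ x m → binomial-^ m x)
    (λ n → trans (sumGap-boundary (λ ℓ → ℓ) n) (countFits-full n))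

  -- On full streets the sum is N² times Cayley's number, that is Nⁿ⁺¹, and this is the value to
  -- which `doubleResolvent N n` telescopes for N = n + 1.
  sumGap-2 : ∀ n {m} → m ≤ n → sumGap (λ ℓ → ℓ * ℓ) n m ≡ doubleResolvent (suc n) m
  sumGap-2 = sumGap-unique (λ ℓ → ℓ * ℓ) doubleResolvent (λ x m → binomial-doubleResolvent m x)
    (λ n → trans (sumGap-boundary (λ ℓ → ℓ * ℓ) n) (trans (*-assoc (suc n) (suc n) _)
       (trans (cong (suc n *_) (countFits-full n)) (sym (doubleResolvent-boundary n)))))

  -- Parking and the first two cars

  free : ∀ {n} → Subset n → ℕ
  free []            = 0
  free (outside ∷ s) = suc (free s)
  free (inside  ∷ s) = free s

  -- The criterion fits for a street on which the spots in s are already occupied.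
  fitsIn : ∀ {n} → Subset n → List (Fin n) → Bool
  fitsIn []      σ = true
  fitsIn (b ∷ s) σ = (length σ <ᵇ suc (free (b ∷ s))) ∧ fitsIn s (dropFirst σ)

  free-⊥ : ∀ n → free (⊥ {n}) ≡ n
  free-⊥ zero    = refl
  free-⊥ (suc n) = cong suc (free-⊥ n)

  fitsIn-⊥ : ∀ {n} (σ : List (Fin n)) → fitsIn ⊥ σ ≡ fits σ
  fitsIn-⊥ {zero}  σ = refl
  fitsIn-⊥ {suc n} σ rewrite free-⊥ n = cong ((length σ <ᵇ suc (suc n)) ∧_) (fitsIn-⊥ (dropFirst σ))

  length-dropFirst : ∀ {n} (σ : List (Fin (suc n))) → length (dropFirst σ) ≤ length σ
  length-dropFirst []          = z≤n
  length-dropFirst (zero  ∷ σ) = m≤n⇒m≤1+n (length-dropFirst σ)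
  length-dropFirst (suc i ∷ σ) = s≤s (length-dropFirst σ)

  free-fill : ∀ {n} (s : Subset n) {s′} → fillFirstFree s ≡ just s′ → free s ≡ suc (free s′)
  free-fill (outside ∷ s) refl = refl
  free-fill (inside  ∷ s) eq with fillFirstFree s in eq₀
  free-fill (inside  ∷ s) refl | just s₀ = free-fill s eq₀

  free-full : ∀ {n} (s : Subset n) → fillFirstFree s ≡ nothing → free s ≡ 0
  free-full []            _ = refl
  free-full (inside  ∷ s) eq with fillFirstFree s in eq₀
  ... | nothing = free-full s eq₀

  -- The tests differ only on suffixes that start no later than the filled spot. As that spot was
  -- the first free one, such suffixes contain every free spot, and the bound on `length τ` makes
  -- both tests succeed. Beyond the spot the streets agree.
  fitsIn-fill : ∀ {n} (s : Subset n) {s′} → fillFirstFree s ≡ just s′ →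
    ∀ τ → length τ ≤ free s′ → fitsIn s τ ≡ fitsIn s′ τ
  fitsIn-fill (outside ∷ s) refl τ l rewrite ≤⇒<ᵇ-suc (m≤n⇒m≤1+n l) | ≤⇒<ᵇ-suc l = refl
  fitsIn-fill (inside  ∷ s) eq   τ l with fillFirstFree s in eq₀
  fitsIn-fill (inside  ∷ s) refl τ l | just s₀
    rewrite free-fill s eq₀ | ≤⇒<ᵇ-suc (m≤n⇒m≤1+n l) | ≤⇒<ᵇ-suc l =
    fitsIn-fill s eq₀ (dropFirst τ) (≤-trans (length-dropFirst τ) l)

  free-park : ∀ {n} (i : Fin n) s {s′} → parkCar i s ≡ just s′ → free s ≡ suc (free s′)
  free-park zero    s       eq = free-fill s eq
  free-park (suc i) (b ∷ s) eq with parkCar i s in eq₀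
  free-park (suc i) (outside ∷ s) refl | just s₀ = cong suc (free-park i s eq₀)
  free-park (suc i) (inside  ∷ s) refl | just s₀ = free-park i s eq₀

  <ᵇ-suc⁻¹ : ∀ {m n} → (m <ᵇ suc n) ≡ true → m ≤ n
  <ᵇ-suc⁻¹ {zero}           _  = z≤n
  <ᵇ-suc⁻¹ {suc m} {suc n} eq = s≤s (<ᵇ-suc⁻¹ eq)

  -- For suffixes starting at or before i, the car count and the number of free spots both drop by
  -- one. Between i and the spot taken only the free spots drop, but there the test at i already
  -- leaves enough room for `fitsIn-fill` to apply.
  fitsIn-park : ∀ {n} (i : Fin n) s {s′} → parkCar i s ≡ just s′ →
    ∀ σ → fitsIn s (i ∷ σ) ≡ fitsIn s′ σ
  fitsIn-park zero    (outside ∷ s) refl σ = refl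
  fitsIn-park zero    (inside  ∷ s) eq   σ with fillFirstFree s in eq₀
  fitsIn-park zero    (inside  ∷ s) refl σ | just s₀
    rewrite free-fill s eq₀ with length σ <ᵇ suc (free s₀) in fit
  ... | true  = fitsIn-fill s eq₀ (dropFirst σ) (≤-trans (length-dropFirst σ) (<ᵇ-suc⁻¹ fit))
  ... | false = refl
  fitsIn-park (suc i) (b ∷ s)       eq   σ with parkCar i s in eq₀
  fitsIn-park (suc i) (outside ∷ s) refl σ | just s₀
    rewrite free-park i s eq₀ | fitsIn-park i s eq₀ (dropFirst σ) = refl
  fitsIn-park (suc i) (inside  ∷ s) refl σ | just s₀
    rewrite free-park i s eq₀ | fitsIn-park i s eq₀ (dropFirst σ) = refl

  ∧-falseʳ : ∀ b → b ∧ false ≡ false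
  ∧-falseʳ true  = refl
  ∧-falseʳ false = refl

  -- No spot from i on is free, so the suffix at i has capacity 0 while the stuck car prefers it.
  fitsIn-stuck : ∀ {n} (i : Fin n) s → parkCar i s ≡ nothing → ∀ σ → fitsIn s (i ∷ σ) ≡ false
  fitsIn-stuck zero    (inside ∷ s) eq σ with fillFirstFree s in eq₀
  ... | nothing rewrite free-full s eq₀ = refl
  fitsIn-stuck (suc i) (b ∷ s)      eq σ with parkCar i s in eq₀
  ... | nothing rewrite fitsIn-stuck i s eq₀ (dropFirst σ) = ∧-falseʳ _

  fitsIn-[] : ∀ {n} (s : Subset n) → fitsIn s [] ≡ true
  fitsIn-[] []      = refl
  fitsIn-[] (b ∷ s) = fitsIn-[] s

  fitsIn-correct : ∀ {m n} (π : Vec (Fin n) m) s → is-just (parkCars π s) ≡ fitsIn s (toList π)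
  fitsIn-correct []      s = sym (fitsIn-[] s)
  fitsIn-correct (i ∷ π) s with parkCar i s in eq
  ... | just s₀ = trans (fitsIn-correct π s₀) (sym (fitsIn-park i s eq (toList π)))
  ... | nothing = sym (fitsIn-stuck i s eq (toList π))

  isParking-fits : ∀ {m n} (π : Vec (Fin n) m) → does (isParking? π) ≡ fits (toList π)
  isParking-fits π = trans lemma (trans (fitsIn-correct π ⊥) (fitsIn-⊥ (toList π)))
    where
    lemma : does (isParking? π) ≡ is-just (parkCars π ⊥)
    lemma with parkCars π ⊥
    ... | just _  = refl
    ... | nothing = refl

  -- Sums over `PF` as sums over tuples

  sum-filter : ∀ {a p} {A : Set a} {P : A → Set p} (P? : ∀ x → Dec (P x)) (f : A → ℕ) xs →
    sumᴸ (map f (filter P? xs)) ≡ sumᴸ (map (λ x → if does (P? x) then f x else 0) xs)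
  sum-filter P? f []       = refl
  sum-filter P? f (x ∷ xs) with does (P? x)
  ... | true  = cong (f x +_) (sum-filter P? f xs)
  ... | false = sum-filter P? f xs

  sum-preferences : ∀ m n (g : List (Fin n) → ℕ) →
    sumᴸ (map (g ∘ toList) (preferences m n)) ≡ sumTuples m g
  sum-preferences zero    n g = +-identityʳ (g [])
  -- `allFin n` is `tabulate id`; the induction over the first entry needs an arbitrary `h` in place
  -- of `id`.
  sum-preferences (suc m) n g = sum-tabulate id
    where
    sum-tabulate : ∀ {k} (h : Fin k → Fin n) →
      sumᴸ (map (g ∘ toList) (cartesianProductWith _∷_ (tabulate h) (preferences m n)))
        ≡ sum (λ i → sumTuples m (g ∘ (h i ∷_)))
    sum-tabulate {zero}  h = refl
    sum-tabulate {suc k} h = begin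
      sumᴸ (map (g ∘ toList) (map (h zero ∷_) π* ++ cartesianProductWith _∷_ (tabulate (h ∘ suc)) π*))
        ≡⟨ cong sumᴸ (map-++ (g ∘ toList) (map (h zero ∷_) π*) _) ⟩
      sumᴸ (map (g ∘ toList) (map (h zero ∷_) π*) ++ _)
        ≡⟨ sum-++ (map (g ∘ toList) (map (h zero ∷_) π*)) _ ⟩
      sumᴸ (map (g ∘ toList) (map (h zero ∷_) π*)) + _
        ≡⟨ cong₂ _+_ (trans (cong sumᴸ (sym (map-∘ π*))) (sum-preferences m n (g ∘ (h zero ∷_))))
                     (sum-tabulate (h ∘ suc)) ⟩
      sum (λ i → sumTuples m (g ∘ (h i ∷_))) ∎
      where
      open ≡-Reasoning
      π* = preferences m n

  sum-PF : ∀ m n (g : List (Fin n) → ℕ) → sumᴸ (map (g ∘ toList) (PF m n)) ≡ sumFits m g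
  sum-PF m n g = trans (sum-filter isParking? (g ∘ toList) (preferences m n)) (trans
    (cong sumᴸ (map-cong (λ π → cong (if_then g (toList π) else 0) (isParking-fits π)) (preferences m n)))
    (sum-preferences m n (λ σ → if fits σ then g σ else 0)))

  -- Preferences of one or two further cars

  below : ℕ → (ℕ → ℕ) → ℕ
  below zero    X = 0
  below (suc f) X = X 0 + below f (X ∘ suc)

  sum-0 : ∀ n → sum {n} (λ _ → 0) ≡ 0
  sum-0 zero    = refl
  sum-0 (suc n) = sum-0 n

  sum-<ᵇ : ∀ {n} f (X : ℕ → ℕ) → f ≤ n →
    sum {n} (λ i → if toℕ i <ᵇ f then X (toℕ i) else 0) ≡ below f X
  sum-<ᵇ {n}     zero    X f≤n       = sum-0 n
  sum-<ᵇ {suc n} (suc f) X (s≤s f≤n) = cong (X 0 +_) (sum-<ᵇ f (X ∘ suc) f≤n)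

  -- The sum of g over the preferences of a car that enters after σ has parked.
  -- The order of the cars does not matter for fits, so this is the first car.
  sumFree : ∀ {n} → List (Fin n) → (Fin n → ℕ) → ℕ
  sumFree σ g = sum (λ i → if toℕ i <ᵇ lastFree σ then g i else 0)

  sumFits-∷ : ∀ {n} m (g : List (Fin n) → ℕ) →
    sumFits (suc m) g ≡ sumFits m (λ σ → sumFree σ (λ i → g (i ∷ σ)))
  sumFits-∷ {n} m g = trans
    (sum-sumTuples m (λ i σ → if fits (i ∷ σ) then g (i ∷ σ) else 0))
    (sumTuples-cong m (λ σ _ → trans
      (sum-cong-≗ (λ i → cong (if_then g (i ∷ σ) else 0) (fits-∷ i σ))) (lemma σ (fits σ))))
    where
    lemma : ∀ σ b → sum (λ i → if b ∧ (toℕ i <ᵇ lastFree σ) then g (i ∷ σ) else 0)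
      ≡ (if b then sumFree σ (λ i → g (i ∷ σ)) else 0)
    lemma σ true  = refl
    lemma σ false = sum-0 n

  sumFree-below : ∀ {n} (σ : List (Fin n)) X → sumFree σ (X ∘ toℕ) ≡ below (lastFree σ) X
  sumFree-below σ X = sum-<ᵇ (lastFree σ) X (lastFree≤n σ)

  sumFree-cong : ∀ {n} (σ : List (Fin n)) {g h} → (∀ i → g i ≡ h i) → sumFree σ g ≡ sumFree σ h
  sumFree-cong σ eq = sum-cong-≗ (λ i → cong (if toℕ i <ᵇ lastFree σ then_else 0) (eq i))

  sumFree-mono : ∀ {n} (σ : List (Fin n)) {g h} → (∀ i → g i ≤ h i) → sumFree σ g ≤ sumFree σ h
  sumFree-mono σ {g} {h} le = sum-mono lemma
    where
    lemma : ∀ i → (if toℕ i <ᵇ lastFree σ then g i else 0) ≤ (if toℕ i <ᵇ lastFree σ then h i else 0)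
    lemma i with toℕ i <ᵇ lastFree σ
    ... | true  = le i
    ... | false = z≤n

  sumFree-+ : ∀ {n} (σ : List (Fin n)) g h → sumFree σ (λ i → g i + h i) ≡ sumFree σ g + sumFree σ h
  sumFree-+ {n} σ g h = trans (sum-cong-≗ lemma)
    (∑-distrib-+ {n} (λ i → if toℕ i <ᵇ lastFree σ then g i else 0) (λ i → if toℕ i <ᵇ lastFree σ then h i else 0))
    where
    lemma : ∀ i → (if toℕ i <ᵇ lastFree σ then g i + h i else 0)
      ≡ (if toℕ i <ᵇ lastFree σ then g i else 0) + (if toℕ i <ᵇ lastFree σ then h i else 0)
    lemma i with toℕ i <ᵇ lastFree σ
    ... | true  = refl
    ... | false = refl

  sumFree-* : ∀ {n} (σ : List (Fin n)) k g → sumFree σ (λ i → k * g i) ≡ k * sumFree σ g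
  sumFree-* {n} σ k g = trans (sum-cong-≗ lemma)
    (sym (*-distribˡ-sum {n} k (λ i → if toℕ i <ᵇ lastFree σ then g i else 0)))
    where
    lemma : ∀ i → (if toℕ i <ᵇ lastFree σ then k * g i else 0) ≡ k * (if toℕ i <ᵇ lastFree σ then g i else 0)
    lemma i with toℕ i <ᵇ lastFree σ
    ... | true  = refl
    ... | false = sym (*-zeroʳ k)

  below-1 : ∀ f → below f (λ _ → 1) ≡ f
  below-1 zero    = refl
  below-1 (suc f) = cong suc (below-1 f)

  below-mono : ∀ {h f} X → h ≤ f → below h X ≤ below f X
  below-mono X z≤n       = z≤n
  below-mono X (s≤s h≤f) = +-monoʳ-≤ (X 0) (below-mono (X ∘ suc) h≤f)

  below-bound : ∀ f X A → (∀ {k} → k < f → X k ≤ A) → below f X ≤ A * f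
  below-bound zero    X A le = z≤n
  below-bound (suc f) X A le = ≤-trans (+-mono-≤ (le z<s) (below-bound f (X ∘ suc) A (le ∘ s≤s)))
    (≤-reflexive (sym (*-suc A f)))

  below-gap : ∀ {h f} X A → h ≤ f → (∀ {k} → k < f → X k ≤ A) → below f X ≤ below h X + A * (f ∸ h)
  below-gap {f = f} X A z≤n       le = below-bound f X A le
  below-gap {suc h} {suc f} X A (s≤s h≤f) le = ≤-trans
    (+-monoʳ-≤ (X 0) (below-gap (X ∘ suc) A h≤f (le ∘ s≤s)))
    (≤-reflexive (sym (+-assoc (X 0) _ _)))

  -- The sum of X k * Y j over the pairs of preferences k, j of two cars that enter after σ.
  pairSum : ∀ {n} → (X Y : ℕ → ℕ) → List (Fin n) → ℕ
  pairSum X Y σ = sumFree σ (λ j → Y (toℕ j) * below (lastFree (j ∷ σ)) X)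

  -- The number of pairs whose preferences are each admissible after σ alone but which do not park
  -- together.
  deficit : ∀ {n} → List (Fin n) → ℕ
  deficit σ = sumFree σ (λ j → lastFree σ ∸ lastFree (j ∷ σ))

  pairSum-≤ : ∀ {n} X Y (σ : List (Fin n)) →
    pairSum X Y σ ≤ below (lastFree σ) X * below (lastFree σ) Y
  pairSum-≤ X Y σ = begin
    pairSum X Y σ
      ≤⟨ sumFree-mono σ (λ j → *-monoʳ-≤ (Y (toℕ j)) (below-mono X (lastFree-∷ j σ))) ⟩
    sumFree σ (λ j → Y (toℕ j) * below (lastFree σ) X)
      ≡⟨ sumFree-cong σ (λ j → *-comm (Y (toℕ j)) _) ⟩
    sumFree σ (λ j → below (lastFree σ) X * Y (toℕ j))
      ≡⟨ sumFree-* σ (below (lastFree σ) X) (Y ∘ toℕ) ⟩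
    below (lastFree σ) X * sumFree σ (Y ∘ toℕ)
      ≡⟨ cong (below (lastFree σ) X *_) (sumFree-below σ Y) ⟩
    below (lastFree σ) X * below (lastFree σ) Y ∎
    where open ≤-Reasoning

  -- The product of the two sums runs over all pairs below `lastFree σ`; each of the `deficit σ`
  -- lost pairs weighs at most `B * A`.
  pairSum-≥ : ∀ {n} X Y A B (σ : List (Fin n)) → (∀ {k} → k < n → X k ≤ A) → (∀ {k} → k < n → Y k ≤ B) →
    below (lastFree σ) X * below (lastFree σ) Y ≤ pairSum X Y σ + B * A * deficit σ
  pairSum-≥ X Y A B σ X≤A Y≤B = begin
    below (lastFree σ) X * below (lastFree σ) Y
      ≡⟨ cong (below (lastFree σ) X *_) (sym (sumFree-below σ Y)) ⟩
    below (lastFree σ) X * sumFree σ (Y ∘ toℕ)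
      ≡⟨ sym (sumFree-* σ (below (lastFree σ) X) (Y ∘ toℕ)) ⟩
    sumFree σ (λ j → below (lastFree σ) X * Y (toℕ j))
      ≤⟨ sumFree-mono σ pointwise ⟩
    sumFree σ (λ j → Y (toℕ j) * below (lastFree (j ∷ σ)) X + B * A * (lastFree σ ∸ lastFree (j ∷ σ)))
      ≡⟨ sumFree-+ σ _ _ ⟩
    pairSum X Y σ + sumFree σ (λ j → B * A * (lastFree σ ∸ lastFree (j ∷ σ)))
      ≡⟨ cong (pairSum X Y σ +_) (sumFree-* σ (B * A) _) ⟩
    pairSum X Y σ + B * A * deficit σ ∎
    where
    open ≤-Reasoning
    f = lastFree σ
    pointwise : ∀ j → below f X * Y (toℕ j)
      ≤ Y (toℕ j) * below (lastFree (j ∷ σ)) X + B * A * (f ∸ lastFree (j ∷ σ))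
    pointwise j = begin
      below f X * Y (toℕ j)
        ≡⟨ *-comm (below f X) _ ⟩
      Y (toℕ j) * below f X
        ≤⟨ *-monoʳ-≤ (Y (toℕ j)) (below-gap X A (lastFree-∷ j σ) (λ k<f → X≤A (<-≤-trans k<f (lastFree≤n σ)))) ⟩
      Y (toℕ j) * (below h X + A * (f ∸ h))
        ≡⟨ lemma (Y (toℕ j)) (below h X) A (f ∸ h) ⟩
      Y (toℕ j) * below h X + Y (toℕ j) * (A * (f ∸ h))
        ≤⟨ +-monoʳ-≤ (Y (toℕ j) * below h X) (*-monoˡ-≤ (A * (f ∸ h)) (Y≤B (toℕ<n j))) ⟩
      Y (toℕ j) * below h X + B * (A * (f ∸ h))
        ≡⟨ cong (Y (toℕ j) * below h X +_) (sym (*-assoc B A _)) ⟩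
      Y (toℕ j) * below h X + B * A * (f ∸ h) ∎
      where
      h = lastFree (j ∷ σ)
      lemma : ∀ y b a d → y * (b + a * d) ≡ y * b + y * (a * d)
      lemma = solve-∀

  -- With unit weights the loss is exact, which ties the total deficit to the number of parking
  -- functions with two more cars.
  pairSum-1 : ∀ {n} (σ : List (Fin n)) →
    pairSum (λ _ → 1) (λ _ → 1) σ + deficit σ ≡ lastFree σ * lastFree σ
  pairSum-1 σ = begin
    pairSum (λ _ → 1) (λ _ → 1) σ + deficit σ
      ≡⟨ sym (sumFree-+ σ _ _) ⟩
    sumFree σ (λ j → 1 * below (lastFree (j ∷ σ)) (λ _ → 1) + (lastFree σ ∸ lastFree (j ∷ σ)))
      ≡⟨ sumFree-cong σ pointwise ⟩
    sumFree σ (λ _ → lastFree σ * 1)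
      ≡⟨ sumFree-* σ (lastFree σ) (λ _ → 1) ⟩
    lastFree σ * sumFree σ (λ _ → 1)
      ≡⟨ cong (lastFree σ *_) (trans (sumFree-below σ (λ _ → 1)) (below-1 (lastFree σ))) ⟩
    lastFree σ * lastFree σ ∎
    where
    open ≡-Reasoning
    pointwise : ∀ j → 1 * below (lastFree (j ∷ σ)) (λ _ → 1) + (lastFree σ ∸ lastFree (j ∷ σ)) ≡ lastFree σ * 1
    pointwise j = trans (cong (_+ (lastFree σ ∸ lastFree (j ∷ σ))) (trans (*-identityˡ _) (below-1 _)))
      (trans (m+[n∸m]≡n (lastFree-∷ j σ)) (sym (*-identityʳ _)))

  sumFits-pair : ∀ {n} m (g : List (Fin n) → ℕ) X Y → (∀ i j σ → g (i ∷ j ∷ σ) ≡ Y (toℕ j) * X (toℕ i)) →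
    sumFits (2 + m) g ≡ sumFits m (pairSum X Y)
  sumFits-pair m g X Y eq = trans (sumFits-∷ (suc m) g) (trans (sumFits-∷ m (λ τ → sumFree τ (λ i → g (i ∷ τ))))
    (sumFits-cong m (λ σ _ → sumFree-cong σ (λ j → trans
      (sumFree-cong (j ∷ σ) (λ i → eq i j σ)) (trans
      (sumFree-* (j ∷ σ) (Y (toℕ j)) (X ∘ toℕ))
      (cong (Y (toℕ j) *_) (sumFree-below (j ∷ σ) X)))))))

  gap+lastFree : ∀ {n} (σ : List (Fin n)) → gap σ + lastFree σ ≡ suc n
  gap+lastFree σ = m∸n+n≡m (m≤n⇒m≤1+n (lastFree≤n σ))

  -- The factor N = n + 1 turns the term `shift`, with its exponent m - 1, into one expression valid
  -- for all m.
  countFits-suc : ∀ n m → m ≤ n → countFits n m * suc n + m * suc n ^ m ≡ suc n * suc n ^ m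
  countFits-suc n m m≤n = trans (lemma m (countFits n m) (suc n)) (trans
    (cong (suc n *_) (countFits-formula n (m≤n⇒m≤1+n m≤n))) refl)
    where
    lemma : ∀ m c x → c * x + m * x ^ m ≡ x * (c + shift (x ^_) m)
    lemma zero    c x = lemma₀ c x
      where
      lemma₀ : ∀ c x → c * x + 0 ≡ x * (c + 0)
      lemma₀ = solve-∀
    lemma (suc m) c x = lemma′ m c x (x ^ m)
      where
      lemma′ : ∀ m c x w → c * x + suc m * (x * w) ≡ x * (c + suc m * w)
      lemma′ = solve-∀

  -- By `pairSum-1` the total is Σ f² minus the count for m + 2 cars. With f = N - ℓ, the part N² Σ
  -- 1 - 2 N Σ ℓ of Σ f² equals that count exactly, and Σ ℓ² remains. The count formula for m + 2
  -- cars requires `m < n`.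
  sumFits-deficit : ∀ n m → m < n → sumFits {n} m deficit ≡ doubleResolvent (suc n) m
  sumFits-deficit n m m<n = +-cancelˡ-≡ K D U (begin
    K + D
      ≡⟨ regroup P₂ D x Q ⟩
    (P₂ + D) + 2 * x * Q
      ≡⟨ cong₂ (λ a b → a + 2 * x * b) pairs (sym (sumGap-1 n m≤n)) ⟩
    sumFits m (λ σ → lastFree σ * lastFree σ) + 2 * x * sumFits m gap
      ≡⟨ cong (sumFits m (λ σ → lastFree σ * lastFree σ) +_) (sym (sumFits-* m (2 * x) gap)) ⟩
    sumFits m (λ σ → lastFree σ * lastFree σ) + sumFits m (λ σ → 2 * x * gap σ)
      ≡⟨ sym (sumFits-+ {n} m _ _) ⟩
    sumFits {n} m (λ σ → lastFree σ * lastFree σ + 2 * x * gap σ)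
      ≡⟨ sumFits-cong m (λ σ _ → square σ) ⟩
    sumFits {n} m (λ σ → x * x * 1 + gap σ * gap σ)
      ≡⟨ sumFits-+ {n} m _ _ ⟩
    sumFits {n} m (λ σ → x * x * 1) + sumFits {n} m (λ σ → gap σ * gap σ)
      ≡⟨ cong₂ _+_ (sumFits-* {n} m (x * x) (λ _ → 1)) (sumGap-2 n m≤n) ⟩
    x * x * Z + U
      ≡⟨ cong (_+ U) (sym balance) ⟩
    K + U ∎)
    where
    open ≡-Reasoning
    x = suc n
    m≤n = <⇒≤ m<n
    Q = x ^ m
    D = sumFits {n} m deficit
    U = doubleResolvent x m
    Z = countFits n m
    P₂ = countFits n (2 + m)
    K = P₂ + 2 * x * Q
    regroup : ∀ p d x q → (p + 2 * x * q) + d ≡ (p + d) + 2 * x * q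
    regroup = solve-∀
    pairs : P₂ + D ≡ sumFits {n} m (λ σ → lastFree σ * lastFree σ)
    pairs = trans (cong (_+ D) (sumFits-pair m (λ _ → 1) (λ _ → 1) (λ _ → 1) (λ _ _ _ → refl)))
      (trans (sym (sumFits-+ {n} m (pairSum (λ _ → 1) (λ _ → 1)) deficit))
             (sumFits-cong m (λ σ _ → pairSum-1 σ)))
    square : ∀ (σ : List (Fin n)) → lastFree σ * lastFree σ + 2 * x * gap σ ≡ x * x * 1 + gap σ * gap σ
    square σ = trans (cong (λ y → lastFree σ * lastFree σ + 2 * y * gap σ) (sym (gap+lastFree σ)))
      (trans (lemma (lastFree σ) (gap σ)) (cong (λ y → y * y * 1 + gap σ * gap σ) (gap+lastFree σ)))
      where
      lemma : ∀ f g → f * f + 2 * (g + f) * g ≡ (g + f) * (g + f) * 1 + g * g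
      lemma = solve-∀
    balance : K ≡ x * x * Z
    balance = +-cancelʳ-≡ (m * (x * Q)) K (x * x * Z) (begin
      (P₂ + 2 * x * Q) + m * (x * Q)     ≡⟨ lemma₁ P₂ m x Q ⟩
      P₂ + (2 + m) * (x * Q)             ≡⟨ countFits-formula n (s≤s m<n) ⟩
      x * (x * Q)                        ≡⟨ cong (x *_) (sym (countFits-suc n m m≤n)) ⟩
      x * (Z * x + m * Q)                ≡⟨ lemma₂ x Z m Q ⟩
      x * x * Z + m * (x * Q)            ∎)
      where
      lemma₁ : ∀ p m x q → (p + 2 * x * q) + m * (x * q) ≡ p + (2 + m) * (x * q)
      lemma₁ = solve-∀
      lemma₂ : ∀ x z m q → x * (z * x + m * q) ≡ x * x * z + m * (x * q)
      lemma₂ = solve-∀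

  -- Power sums

  powerSum : ℕ → ℕ → ℕ
  powerSum p f = below f (λ k → suc k ^ p)

  below-telescope : ∀ c X (G ψ : ℕ → ℕ) → (∀ a → c * X a + G a ≡ G (suc a) + ψ a) →
    ∀ f → c * below f X + G 0 ≡ G f + below f ψ
  below-telescope c X G ψ step zero    = trans (cong (_+ G 0) (*-zeroʳ c)) (sym (+-identityʳ (G 0)))
  below-telescope c X G ψ step (suc f) = begin
    c * (X 0 + below f (X ∘ suc)) + G 0
      ≡⟨ lemma₁ c (X 0) (below f (X ∘ suc)) (G 0) ⟩
    (c * X 0 + G 0) + c * below f (X ∘ suc)
      ≡⟨ cong (_+ c * below f (X ∘ suc)) (step 0) ⟩
    (G 1 + ψ 0) + c * below f (X ∘ suc)
      ≡⟨ lemma₂ (G 1) (ψ 0) (c * below f (X ∘ suc)) ⟩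
    (c * below f (X ∘ suc) + G 1) + ψ 0
      ≡⟨ cong (_+ ψ 0) (below-telescope c (X ∘ suc) (G ∘ suc) (ψ ∘ suc) (step ∘ suc) f) ⟩
    (G (suc f) + below f (ψ ∘ suc)) + ψ 0
      ≡⟨ lemma₃ (G (suc f)) (below f (ψ ∘ suc)) (ψ 0) ⟩
    G (suc f) + (ψ 0 + below f (ψ ∘ suc)) ∎
    where
    open ≡-Reasoning
    lemma₁ : ∀ c x b g → c * (x + b) + g ≡ (c * x + g) + c * b
    lemma₁ = solve-∀
    lemma₂ : ∀ g p b → (g + p) + b ≡ (b + g) + p
    lemma₂ = solve-∀
    lemma₃ : ∀ g b p → (g + b) + p ≡ g + (p + b)
    lemma₃ = solve-∀

  -- trapezoid a p is the error of the trapezoidal rule for 2 (p + 1) ∫ tᵖ dt on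
  -- [a, a + 1], and tangent a p is the auxiliary term in its recursion on p.
  tangent : ℕ → ℕ → ℕ
  tangent a zero    = 0
  tangent a (suc p) = a * tangent a p + suc p * suc a ^ p

  trapezoid : ℕ → ℕ → ℕ
  trapezoid a zero    = 0
  trapezoid a (suc p) = a * trapezoid a p + tangent a p

  -- As (a + 1)ᵖ⁺¹ - (p + 1) (a + 1)ᵖ = (a - p) (a + 1)ᵖ, this identifies `tangent a p` as the
  -- height of tᵖ⁺¹ at t = a above its tangent line at a + 1.
  tangent-eq : ∀ a p → p * suc a ^ p + a * a ^ p ≡ tangent a p + a * suc a ^ p
  tangent-eq a zero    = refl
  tangent-eq a (suc p) = begin
    suc p * (suc a * B) + a * (a * A)                ≡⟨ lemma₁ a p A B ⟩
    a * (p * B + a * A) + (a + suc p) * B            ≡⟨ cong (λ x → a * x + (a + suc p) * B) (tangent-eq a p) ⟩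
    a * (tangent a p + a * B) + (a + suc p) * B      ≡⟨ lemma₂ a p (tangent a p) B ⟩
    (a * tangent a p + suc p * B) + a * (suc a * B)  ∎
    where
    open ≡-Reasoning
    A = a ^ p
    B = suc a ^ p
    lemma₁ : ∀ a p A B → suc p * (suc a * B) + a * (a * A) ≡ a * (p * B + a * A) + (a + suc p) * B
    lemma₁ = solve-∀
    lemma₂ : ∀ a p H B → a * (H + a * B) + (a + suc p) * B ≡ (a * H + suc p * B) + a * (suc a * B)
    lemma₂ = solve-∀

  trapezoid-eq : ∀ a p → suc p * (a ^ p + suc a ^ p) + 2 * a ^ suc p ≡ 2 * suc a ^ suc p + trapezoid a p
  trapezoid-eq a zero    = lemma a
    where
    lemma : ∀ a → 1 * (1 + 1) + 2 * (a * 1) ≡ 2 * (suc a * 1) + 0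
    lemma = solve-∀
  -- The cancelled terms are those that a times the induction hypothesis and `tangent-eq` contribute
  -- besides the error terms.
  trapezoid-eq a (suc p) = +-cancelʳ-≡ (a * (2 * (suc a * B)) + a * B) _ _ (begin
    (suc (suc p) * (a * A + suc a * B) + 2 * (a * (a * A))) + (a * (2 * (suc a * B)) + a * B)
      ≡⟨ lemma₁ a p A B ⟩
    2 * (suc a * (suc a * B)) + (a * (suc p * (A + B) + 2 * (a * A)) + (p * B + a * A))
      ≡⟨ cong (2 * (suc a * (suc a * B)) +_) (cong₂ (λ x y → a * x + y) (trapezoid-eq a p) (tangent-eq a p)) ⟩
    2 * (suc a * (suc a * B)) + (a * (2 * (suc a * B) + trapezoid a p) + (tangent a p + a * B))
      ≡⟨ lemma₂ a (trapezoid a p) (tangent a p) B ⟩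
    (2 * (suc a * (suc a * B)) + (a * trapezoid a p + tangent a p)) + (a * (2 * (suc a * B)) + a * B) ∎)
    where
    open ≡-Reasoning
    A = a ^ p
    B = suc a ^ p
    lemma₁ : ∀ a p A B →
      (suc (suc p) * (a * A + suc a * B) + 2 * (a * (a * A))) + (a * (2 * (suc a * B)) + a * B)
      ≡ 2 * (suc a * (suc a * B)) + (a * (suc p * (A + B) + 2 * (a * A)) + (p * B + a * A))
    lemma₁ = solve-∀
    lemma₂ : ∀ a E H B →
      2 * (suc a * (suc a * B)) + (a * (2 * (suc a * B) + E) + (H + a * B))
      ≡ (2 * (suc a * (suc a * B)) + (a * E + H)) + (a * (2 * (suc a * B)) + a * B)
    lemma₂ = solve-∀

  -- `triangle p` is p (p + 1) / 2 and `tetrahedron p` is (p + 1 choose 3); they collect the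
  -- increments of the recursions for `tangent` and `trapezoid`.
  triangle : ℕ → ℕ
  triangle zero    = 0
  triangle (suc p) = triangle p + suc p

  tetrahedron : ℕ → ℕ
  tetrahedron zero    = 0
  tetrahedron (suc p) = tetrahedron p + triangle p

  -- The factor `n` on the left, like `n * n` in `trapezoid-bound`, replaces the exponents p - 1 and
  -- p - 2, which may be negative.
  tangent-bound : ∀ {a n} → a < n → ∀ p → n * tangent a p ≤ triangle p * n ^ p
  tangent-bound {a} {n} a<n zero    = ≤-reflexive (*-zeroʳ n)
  tangent-bound {a} {n} a<n (suc p) = begin
    n * (a * tangent a p + suc p * suc a ^ p)        ≡⟨ lemma₁ n a (tangent a p) (suc p) (suc a ^ p) ⟩
    a * (n * tangent a p) + suc p * (n * suc a ^ p)
      ≤⟨ +-mono-≤ (*-mono-≤ (<⇒≤ a<n) (tangent-bound a<n p))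
                  (*-monoʳ-≤ (suc p) (*-monoʳ-≤ n (^-monoˡ-≤ p a<n))) ⟩
    n * (triangle p * n ^ p) + suc p * (n * n ^ p)   ≡⟨ lemma₂ n (triangle p) (suc p) (n ^ p) ⟩
    (triangle p + suc p) * (n * n ^ p)               ∎
    where
    open ≤-Reasoning
    lemma₁ : ∀ n a H k B → n * (a * H + k * B) ≡ a * (n * H) + k * (n * B)
    lemma₁ = solve-∀
    lemma₂ : ∀ n t k N → n * (t * N) + k * (n * N) ≡ (t + k) * (n * N)
    lemma₂ = solve-∀

  trapezoid-bound : ∀ {a n} → a < n → ∀ p → n * n * trapezoid a p ≤ tetrahedron p * n ^ p
  trapezoid-bound {a} {n} a<n zero    = ≤-reflexive (*-zeroʳ (n * n))
  trapezoid-bound {a} {n} a<n (suc p) = begin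
    n * n * (a * trapezoid a p + tangent a p)              ≡⟨ lemma₁ n a (trapezoid a p) (tangent a p) ⟩
    a * (n * n * trapezoid a p) + n * (n * tangent a p)
      ≤⟨ +-mono-≤ (*-mono-≤ (<⇒≤ a<n) (trapezoid-bound a<n p)) (*-monoʳ-≤ n (tangent-bound a<n p)) ⟩
    n * (tetrahedron p * n ^ p) + n * (triangle p * n ^ p) ≡⟨ lemma₂ n (tetrahedron p) (triangle p) (n ^ p) ⟩
    (tetrahedron p + triangle p) * (n * n ^ p)             ∎
    where
    open ≤-Reasoning
    lemma₁ : ∀ n a E H → n * n * (a * E + H) ≡ a * (n * n * E) + n * (n * H)
    lemma₁ = solve-∀
    lemma₂ : ∀ n s t N → n * (s * N) + n * (t * N) ≡ (s + t) * (n * N)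
    lemma₂ = solve-∀

  below-bound* : ∀ c X A f → (∀ {a} → a < f → c * X a ≤ A) → c * below f X ≤ f * A
  below-bound* c X A zero    le = ≤-reflexive (*-zeroʳ c)
  below-bound* c X A (suc f) le = ≤-trans (≤-reflexive (*-distribˡ-+ c (X 0) _))
    (+-mono-≤ (le z<s) (below-bound* c (X ∘ suc) A f (le ∘ s≤s)))

  -- Euler-Maclaurin summation with the trapezoidal errors as remainder. `1 ≤ p` makes the boundary
  -- term 0ᵖ vanish.
  powerSum-trapezoid : ∀ p → 1 ≤ p → ∀ f →
    2 * suc p * powerSum p f ≡ (2 * f ^ suc p + suc p * f ^ p) + below f (λ a → trapezoid a p)
  powerSum-trapezoid p@(suc _) _ f = trans (sym (trans
      (cong (2 * suc p * powerSum p f +_) (*-zeroʳ (suc p)))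
      (+-identityʳ _)))
    (below-telescope (2 * suc p) (λ k → suc k ^ p) (λ a → 2 * a ^ suc p + suc p * a ^ p) (λ a → trapezoid a p) step f)
    where
    step : ∀ a → 2 * suc p * suc a ^ p + (2 * a ^ suc p + suc p * a ^ p)
      ≡ (2 * suc a ^ suc p + suc p * suc a ^ p) + trapezoid a p
    step a = begin
      2 * suc p * suc a ^ p + (2 * a ^ suc p + suc p * a ^ p)
        ≡⟨ lemma₁ (suc p) (suc a ^ p) (a ^ suc p) (a ^ p) ⟩
      (suc p * (a ^ p + suc a ^ p) + 2 * a ^ suc p) + suc p * suc a ^ p
        ≡⟨ cong (_+ suc p * suc a ^ p) (trapezoid-eq a p) ⟩
      (2 * suc a ^ suc p + trapezoid a p) + suc p * suc a ^ p
        ≡⟨ lemma₂ (2 * suc a ^ suc p) (trapezoid a p) (suc p * suc a ^ p) ⟩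
      (2 * suc a ^ suc p + suc p * suc a ^ p) + trapezoid a p ∎
      where
      open ≡-Reasoning
      lemma₁ : ∀ k B C A → 2 * k * B + (2 * C + k * A) ≡ (k * (A + B) + 2 * C) + k * B
      lemma₁ = solve-∀
      lemma₂ : ∀ x y z → (x + y) + z ≡ (x + z) + y
      lemma₂ = solve-∀

  trapezoid-sum-bound : ∀ p f n → f ≤ n → n * below f (λ a → trapezoid a p) ≤ tetrahedron p * n ^ p
  trapezoid-sum-bound p zero    zero    _   = z≤n
  trapezoid-sum-bound p f       (suc k) f≤n = *-cancelˡ-≤ n (begin
    n * (n * below f (λ a → trapezoid a p)) ≡⟨ sym (*-assoc n n _) ⟩
    n * n * below f (λ a → trapezoid a p)
      ≤⟨ below-bound* (n * n) _ _ f (λ a<f → trapezoid-bound (<-≤-trans a<f f≤n) p) ⟩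
    f * (tetrahedron p * n ^ p) ≤⟨ *-monoˡ-≤ _ f≤n ⟩
    n * (tetrahedron p * n ^ p) ∎)
    where
    open ≤-Reasoning
    n = suc k

  -- Linearisation of powers and bounds for power sums

  -- The remainder of the linearisation of tᵖ⁺¹ at t = n, evaluated at n − L = f.
  convexity : ℕ → ℕ → ℕ → ℕ
  convexity f L zero    = 0
  convexity f L (suc p) = f * convexity f L p + suc p * (L * L) * (f + L) ^ p

  convexity-eq : ∀ f L p →
    f ^ suc p + suc p * L * (f + L) ^ p ≡ (f + L) ^ suc p + convexity f L p
  convexity-eq f L zero    = lemma f L
    where
    lemma : ∀ f L → f * 1 + 1 * L * 1 ≡ (f + L) * 1 + 0
    lemma = solve-∀
  convexity-eq f L (suc p) = begin
    f * F + suc (suc p) * L * (n * N)                               ≡⟨ lemma₁ f L p F N ⟩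
    f * (F + suc p * L * N) + (suc p * (L * L) * N + L * (n * N))   ≡⟨ cong (λ x → f * x + (suc p * (L * L) * N + L * (n * N))) (convexity-eq f L p) ⟩
    f * (n * N + convexity f L p) + (suc p * (L * L) * N + L * (n * N)) ≡⟨ lemma₂ f L p (convexity f L p) N ⟩
    n * (n * N) + (f * convexity f L p + suc p * (L * L) * N)       ∎
    where
    open ≡-Reasoning
    n = f + L
    N = n ^ p
    F = f ^ suc p
    lemma₁ : ∀ f L p F N → f * F + suc (suc p) * L * ((f + L) * N)
      ≡ f * (F + suc p * L * N) + (suc p * (L * L) * N + L * ((f + L) * N))
    lemma₁ = solve-∀
    lemma₂ : ∀ f L p β N → f * ((f + L) * N + β) + (suc p * (L * L) * N + L * ((f + L) * N))
      ≡ (f + L) * ((f + L) * N) + (f * β + suc p * (L * L) * N)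
    lemma₂ = solve-∀

  convexity-bound : ∀ f L p → (f + L) * convexity f L p ≤ triangle p * (L * L) * (f + L) ^ p
  convexity-bound f L zero    = ≤-reflexive (*-zeroʳ (f + L))
  convexity-bound f L (suc p) = begin
    n * (f * convexity f L p + suc p * (L * L) * N)     ≡⟨ lemma₁ n f (convexity f L p) (suc p) L N ⟩
    f * (n * convexity f L p) + n * (suc p * (L * L) * N)
      ≤⟨ +-monoˡ-≤ _ (*-mono-≤ (m≤m+n f L) (convexity-bound f L p)) ⟩
    n * (triangle p * (L * L) * N) + n * (suc p * (L * L) * N) ≡⟨ lemma₂ n (triangle p) (suc p) L N ⟩
    (triangle p + suc p) * (L * L) * (n * N)            ∎
    where
    open ≤-Reasoning
    n = f + L
    N = n ^ p
    lemma₁ : ∀ n f β k L N → n * (f * β + k * (L * L) * N) ≡ f * (n * β) + n * (k * (L * L) * N)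
    lemma₁ = solve-∀
    lemma₂ : ∀ n t k L N → n * (t * (L * L) * N) + n * (k * (L * L) * N) ≡ (t + k) * (L * L) * (n * N)
    lemma₂ = solve-∀

  -- Serves to replace fᵖ by nᵖ in the trapezoidal correction of the lower bound; for the upper
  -- bound monotonicity is enough.
  ^-lipschitz : ∀ f L p → (f + L) * (f + L) ^ p ≤ (f + L) * f ^ p + p * L * (f + L) ^ p
  ^-lipschitz f L zero    = m≤m+n _ _
  ^-lipschitz f L (suc p) = begin
    n * (n * N)                                   ≤⟨ *-monoʳ-≤ n (^-lipschitz f L p) ⟩
    n * (n * F + p * L * N)                       ≡⟨ lemma₁ f L p F N ⟩
    n * (f * F) + n * (L * F) + p * L * (n * N)
      ≤⟨ +-monoˡ-≤ (p * L * (n * N)) (+-monoʳ-≤ (n * (f * F)) (*-monoʳ-≤ n (*-monoʳ-≤ L (^-monoˡ-≤ p (m≤m+n f L))))) ⟩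
    n * (f * F) + n * (L * N) + p * L * (n * N)   ≡⟨ lemma₂ n f L p F N ⟩
    n * (f * F) + suc p * L * (n * N)             ∎
    where
    open ≤-Reasoning
    n = f + L
    N = n ^ p
    F = f ^ p
    lemma₁ : ∀ f L p F N → (f + L) * ((f + L) * F + p * L * N)
      ≡ (f + L) * (f * F) + (f + L) * (L * F) + p * L * ((f + L) * N)
    lemma₁ = solve-∀
    lemma₂ : ∀ n f L p F N → n * (f * F) + n * (L * N) + p * L * (n * N) ≡ n * (f * F) + suc p * L * (n * N)
    lemma₂ = solve-∀

  -- The three summands come from the doubled `convexity`, from the trapezoidal errors, and from
  -- `^-lipschitz` applied to (p + 1) fᵖ. The last arises only in the lower bound; the upper bound
  -- adds it as slack so that both share a constant.
  powerSumError : ℕ → ℕ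
  powerSumError p = 2 * triangle p + tetrahedron p + suc p * p

  module _ (p : ℕ) (1≤p : 1 ≤ p) (f L : ℕ) where

    private
      n N F R S ℓ² : ℕ
      n = f + L
      N = n ^ p
      F = f ^ p
      R = below f (λ a → trapezoid a p)
      S = powerSum p f
      -- `suc L` is the gap when f is the last free spot. Being at least 1, its square also absorbs
      -- the errors that do not involve L.
      ℓ² = suc L * suc L

      L²≤ℓ² : L * L ≤ ℓ²
      L²≤ℓ² = *-mono-≤ (n≤1+n L) (n≤1+n L)

      split : 2 * suc p * S + 2 * suc p * L * N ≡ 2 * (n * N + convexity f L p) + (suc p * F + R)
      split = trans (cong (_+ 2 * suc p * L * N) (powerSum-trapezoid p 1≤p f)) (trans
        (lemma (suc p) (f * F) F R L N)
        (cong (λ x → 2 * x + (suc p * F + R)) (convexity-eq f L p)))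
        where
        lemma : ∀ k G F R L N → ((2 * G + k * F) + R) + 2 * k * L * N ≡ 2 * (G + k * L * N) + (k * F + R)
        lemma = solve-∀

    powerSum-upper : n * (2 * suc p * S + 2 * suc p * L * N)
      ≤ n * (2 * (n * N) + suc p * N) + powerSumError p * ℓ² * N
    powerSum-upper = begin
      n * (2 * suc p * S + 2 * suc p * L * N)
        ≡⟨ cong (n *_) split ⟩
      n * (2 * (n * N + convexity f L p) + (suc p * F + R))
        ≡⟨ lemma₁ n N (convexity f L p) (suc p) F R ⟩
      n * (2 * (n * N) + suc p * F) + (2 * (n * convexity f L p) + n * R)
        ≤⟨ +-mono-≤ (*-monoʳ-≤ n (+-monoʳ-≤ (2 * (n * N)) (*-monoʳ-≤ (suc p) (^-monoˡ-≤ p (m≤m+n f L)))))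
             (+-mono-≤ (*-monoʳ-≤ 2 (≤-trans (convexity-bound f L p) (*-monoˡ-≤ N (*-monoʳ-≤ (triangle p) L²≤ℓ²))))
               (≤-trans (trapezoid-sum-bound p f n (m≤m+n f L))
                 (*-monoˡ-≤ N (≤-trans (≤-reflexive (sym (*-identityʳ (tetrahedron p)))) (*-monoʳ-≤ (tetrahedron p) (s≤s z≤n)))))) ⟩
      n * (2 * (n * N) + suc p * N) + (2 * (triangle p * ℓ² * N) + tetrahedron p * ℓ² * N)
        ≤⟨ +-monoʳ-≤ (n * (2 * (n * N) + suc p * N)) (m≤m+n _ (suc p * p * ℓ² * N)) ⟩
      n * (2 * (n * N) + suc p * N) + ((2 * (triangle p * ℓ² * N) + tetrahedron p * ℓ² * N) + suc p * p * ℓ² * N)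
        ≡⟨ cong (n * (2 * (n * N) + suc p * N) +_) (lemma₂ (triangle p) (tetrahedron p) (suc p * p) ℓ² N) ⟩
      n * (2 * (n * N) + suc p * N) + powerSumError p * ℓ² * N ∎
      where
      open ≤-Reasoning
      lemma₁ : ∀ n N β k F R → n * (2 * (n * N + β) + (k * F + R))
        ≡ n * (2 * (n * N) + k * F) + (2 * (n * β) + n * R)
      lemma₁ = solve-∀
      lemma₂ : ∀ s t k l N → (2 * (s * l * N) + t * l * N) + k * l * N ≡ (2 * s + t + k) * l * N
      lemma₂ = solve-∀

    powerSum-lower : n * (2 * (n * N) + suc p * N)
      ≤ n * (2 * suc p * S + 2 * suc p * L * N) + powerSumError p * ℓ² * N
    powerSum-lower = begin
      n * (2 * (n * N) + suc p * N)
        ≡⟨ lemma₁ n N (suc p) ⟩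
      n * (2 * (n * N)) + suc p * (n * N)
        ≤⟨ +-mono-≤ (*-monoʳ-≤ n (*-monoʳ-≤ 2 (m≤m+n (n * N) (convexity f L p))))
                    (*-monoʳ-≤ (suc p) (≤-trans (^-lipschitz f L p)
                      (+-monoʳ-≤ (n * F) (*-monoˡ-≤ N (*-monoʳ-≤ p (≤-trans (n≤1+n L) (m≤m*n (suc L) (suc L)))))))) ⟩
      n * (2 * (n * N + convexity f L p)) + suc p * (n * F + p * ℓ² * N)
        ≤⟨ m≤m+n _ (n * R + (2 * triangle p + tetrahedron p) * ℓ² * N) ⟩
      (n * (2 * (n * N + convexity f L p)) + suc p * (n * F + p * ℓ² * N)) + (n * R + (2 * triangle p + tetrahedron p) * ℓ² * N)
        ≡⟨ lemma₂ n (n * N + convexity f L p) (suc p) p F R ℓ² N (2 * triangle p + tetrahedron p) ⟩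
      n * (2 * (n * N + convexity f L p) + (suc p * F + R)) + powerSumError p * ℓ² * N
        ≡⟨ cong (λ x → n * x + powerSumError p * ℓ² * N) (sym split) ⟩
      n * (2 * suc p * S + 2 * suc p * L * N) + powerSumError p * ℓ² * N ∎
      where
      open ≤-Reasoning
      lemma₁ : ∀ n N k → n * (2 * (n * N) + k * N) ≡ n * (2 * (n * N)) + k * (n * N)
      lemma₁ = solve-∀
      lemma₂ : ∀ n G k p F R l N t → (n * (2 * G) + k * (n * F + p * l * N)) + (n * R + t * l * N)
        ≡ n * (2 * G + (k * F + R)) + (t + k * p) * l * N
      lemma₂ = solve-∀

open Counting
open import Defs
open import Data.Fin using (Fin; zero; suc; toℕ)
open import Data.Integer as ℤ using (+_; +[1+_])
import Data.Integer.Properties as ℤ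
open import Data.List using (List; []; _∷_; length; map; foldr)
open import Data.Nat as ℕ using (ℕ; zero; suc)
open import Data.Nat.ListAction using () renaming (sum to sumᴸ)
import Data.Nat.Properties as ℕ
open import Data.Nat.Properties using (m<n⇒0<n)
open import Data.Product using (_×_; _,_; proj₁; proj₂; ∃-syntax; Σ-syntax)
open import Data.Rational
open import Data.Rational.Properties
import Data.Rational.Unnormalised as ℚᵘ
import Data.Rational.Unnormalised.Properties as ℚᵘ
open import Data.Sum using (inj₁; inj₂)
open import Data.Vec using (Vec; []; _∷_; toList)
open import Function using (_∘_)
open import Level using (0ℓ)
open import Relation.Binary.PropositionalEquality
open import Relation.Nullary using (contradiction)
open import Relation.Nullary.Decidable using (dec⇒maybe)
open import Tactic.RingSolver using (solve-∀)
open import Tactic.RingSolver.Core.AlmostCommutativeRing using (AlmostCommutativeRing; fromCommutativeRing)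

-- Rational arithmetic

ℚ-ring : AlmostCommutativeRing 0ℓ 0ℓ
ℚ-ring = fromCommutativeRing +-*-commutativeRing (λ x → dec⇒maybe (0ℚ ≟ x))

toℚᵘ-fromℕ : ∀ k → toℚᵘ (fromℕ k) ℚᵘ.≃ ℚᵘ.mkℚᵘ (+ k) 0
toℚᵘ-fromℕ k = toℚᵘ-fromℚᵘ (ℚᵘ.mkℚᵘ (+ k) 0)

fromℕ-+ : ∀ m n → fromℕ (m ℕ.+ n) ≡ fromℕ m + fromℕ n
fromℕ-+ m n = toℚᵘ-injective (ℚᵘ.≃-trans (toℚᵘ-fromℕ (m ℕ.+ n)) (ℚᵘ.≃-sym
  (ℚᵘ.≃-trans (toℚᵘ-homo-+ (fromℕ m) (fromℕ n)) (ℚᵘ.≃-trans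
    (ℚᵘ.+-cong (toℚᵘ-fromℕ m) (toℚᵘ-fromℕ n))
    (ℚᵘ.*≡* (cong (ℤ._* + 1) (cong₂ ℤ._+_ (ℤ.*-identityʳ (+ m)) (ℤ.*-identityʳ (+ n)))))))))

fromℕ-* : ∀ m n → fromℕ (m ℕ.* n) ≡ fromℕ m * fromℕ n
fromℕ-* m n = toℚᵘ-injective (ℚᵘ.≃-trans (toℚᵘ-fromℕ (m ℕ.* n)) (ℚᵘ.≃-sym
  (ℚᵘ.≃-trans (toℚᵘ-homo-* (fromℕ m) (fromℕ n)) (ℚᵘ.≃-trans
    (ℚᵘ.*-cong (toℚᵘ-fromℕ m) (toℚᵘ-fromℕ n))
    (ℚᵘ.*≡* (cong (ℤ._* + 1) (sym (ℤ.pos-* m n))))))))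

fromℕ-suc : ∀ n → fromℕ (suc n) ≡ 1ℚ + fromℕ n
fromℕ-suc n = fromℕ-+ 1 n

fromℕ-mono-≤ : ∀ {m n} → m ℕ.≤ n → fromℕ m ≤ fromℕ n
fromℕ-mono-≤ {m} {n} m≤n = toℚᵘ-cancel-≤ (ℚᵘ.≤-respˡ-≃ (ℚᵘ.≃-sym (toℚᵘ-fromℕ m))
  (ℚᵘ.≤-respʳ-≃ (ℚᵘ.≃-sym (toℚᵘ-fromℕ n)) (ℚᵘ.*≤* (ℤ.*-monoʳ-≤-nonNeg (+ 1) (ℤ.+≤+ m≤n)))))

fromℕ-mono-< : ∀ {m n} → m ℕ.< n → fromℕ m < fromℕ n
fromℕ-mono-< {m} {n} m<n = toℚᵘ-cancel-< (ℚᵘ.<-respˡ-≃ (ℚᵘ.≃-sym (toℚᵘ-fromℕ m))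
  (ℚᵘ.<-respʳ-≃ (ℚᵘ.≃-sym (toℚᵘ-fromℕ n)) (ℚᵘ.*<* (ℤ.*-monoʳ-<-pos (+ 1) (ℤ.+<+ m<n)))))

fromℕ-cancel-< : ∀ {m n} → fromℕ m < fromℕ n → m ℕ.< n
fromℕ-cancel-< {m} {n} lt = ℕ.≰⇒> (λ n≤m → <-irrefl refl (<-≤-trans lt (fromℕ-mono-≤ n≤m)))

0≤fromℕ : ∀ n → 0ℚ ≤ fromℕ n
0≤fromℕ n = fromℕ-mono-≤ {0} {n} ℕ.z≤n

/-*-cancel : ∀ a d .{{_ : ℕ.NonZero d}} → (+ a / d) * fromℕ d ≡ fromℕ a
/-*-cancel a (suc d) = toℚᵘ-injective (ℚᵘ.≃-trans (toℚᵘ-homo-* (+ a / suc d) (fromℕ (suc d)))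
  (ℚᵘ.≃-trans (ℚᵘ.*-cong (toℚᵘ-fromℚᵘ (ℚᵘ.mkℚᵘ (+ a) d)) (toℚᵘ-fromℕ (suc d)))
  (ℚᵘ.≃-trans (ℚᵘ.*≡* (trans (ℤ.*-identityʳ _) (cong (+ a ℤ.*_) (cong +_ (sym (ℕ.*-identityʳ (suc d)))))))
    (ℚᵘ.≃-sym (toℚᵘ-fromℕ a)))))

∣∣-≤ : ∀ {x y} → x ≤ y → - x ≤ y → ∣ x ∣ ≤ y
∣∣-≤ {x} {y} x≤y -x≤y with ∣p∣≡p∨∣p∣≡-p x
... | inj₁ eq = subst (_≤ y) (sym eq) x≤y
... | inj₂ eq = subst (_≤ y) (sym eq) -x≤y

*-monoˡ : ∀ {c x y} → 0ℚ ≤ c → x ≤ y → c * x ≤ c * y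
*-monoˡ {c} 0≤c = *-monoˡ-≤-nonNeg c {{nonNegative 0≤c}}

*-monoʳ : ∀ {c x y} → 0ℚ ≤ c → x ≤ y → x * c ≤ y * c
*-monoʳ {c} 0≤c = *-monoʳ-≤-nonNeg c {{nonNegative 0≤c}}

*-mono : ∀ {a b x y} → 0ℚ ≤ a → 0ℚ ≤ y → a ≤ b → x ≤ y → a * x ≤ b * y
*-mono 0≤a 0≤y a≤b x≤y = ≤-trans (*-monoˡ 0≤a x≤y) (*-monoʳ 0≤y a≤b)

*-cancelˡ : ∀ {c x y} → 0ℚ < c → c * x ≤ c * y → x ≤ y
*-cancelˡ {c} 0<c = *-cancelˡ-≤-pos c {{positive 0<c}}

0≤* : ∀ {x y} → 0ℚ ≤ x → 0ℚ ≤ y → 0ℚ ≤ x * y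
0≤* {x} {y} 0≤x 0≤y = subst (_≤ x * y) (*-zeroʳ x) (*-monoˡ 0≤x 0≤y)

0<* : ∀ {x y} → 0ℚ < x → 0ℚ < y → 0ℚ < x * y
0<* {x} {y} 0<x 0<y = subst (_< x * y) (*-zeroʳ x) (*-monoʳ-<-pos x {{positive 0<x}} 0<y)

0≤+ : ∀ {x y} → 0ℚ ≤ x → 0ℚ ≤ y → 0ℚ ≤ x + y
0≤+ {x} {y} 0≤x 0≤y = subst (_≤ x + y) (+-identityˡ 0ℚ) (+-mono-≤ 0≤x 0≤y)

x≤x+y : ∀ {x y} → 0ℚ ≤ y → x ≤ x + y
x≤x+y {x} {y} 0≤y = subst (_≤ x + y) (+-identityʳ x) (+-monoʳ-≤ x 0≤y)

≤-minus : ∀ {x y z} → x ≤ y + z → x - y ≤ z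
≤-minus {x} {y} {z} le = subst (x - y ≤_) (lemma y z) (+-monoˡ-≤ (- y) le)
  where
  lemma : ∀ y z → (y + z) - y ≡ z
  lemma = solve-∀ ℚ-ring

∣-∣-≤ : ∀ {x y z} → x ≤ y + z → y ≤ x + z → ∣ x - y ∣ ≤ z
∣-∣-≤ {x} {y} {z} le ge = ∣∣-≤ (≤-minus le) (subst (_≤ z) (lemma x y) (≤-minus ge))
  where
  lemma : ∀ x y → y - x ≡ - (x - y)
  lemma = solve-∀ ℚ-ring

∣∣-triangle : ∀ x y z {a b} → ∣ x - y ∣ ≤ a → ∣ y - z ∣ ≤ b → ∣ x - z ∣ ≤ a + b
∣∣-triangle x y z {a} {b} le₁ le₂ = subst (λ w → ∣ w ∣ ≤ a + b) (lemma x y z)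
  (≤-trans (∣p+q∣≤∣p∣+∣q∣ (x - y) (y - z)) (+-mono-≤ le₁ le₂))
  where
  lemma : ∀ x y z → (x - y) + (y - z) ≡ x - z
  lemma = solve-∀ ℚ-ring

∣*∣-≤ : ∀ x y {a b} → ∣ x ∣ ≤ a → ∣ y ∣ ≤ b → ∣ x * y ∣ ≤ a * b
∣*∣-≤ x y {a} {b} le₁ le₂ = subst (_≤ a * b) (sym (∣p*q∣≡∣p∣*∣q∣ x y))
  (*-mono (0≤∣p∣ x) (≤-trans (0≤∣p∣ y) le₂) le₁ le₂)

-- Sums over lists and expectations

∑ : ∀ {a} {A : Set a} → List A → (A → ℚ) → ℚ
∑ xs f = foldr _+_ 0ℚ (map f xs)

module _ {a} {A : Set a} where

  ∑-cong : ∀ (xs : List A) {f g} → (∀ x → f x ≡ g x) → ∑ xs f ≡ ∑ xs g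
  ∑-cong []       eq = refl
  ∑-cong (x ∷ xs) eq = cong₂ _+_ (eq x) (∑-cong xs eq)

  ∑-fromℕ : ∀ (xs : List A) f → ∑ xs (fromℕ ∘ f) ≡ fromℕ (sumᴸ (map f xs))
  ∑-fromℕ []       f = refl
  ∑-fromℕ (x ∷ xs) f = trans (cong (_+_ (fromℕ (f x))) (∑-fromℕ xs f)) (sym (fromℕ-+ (f x) _))

  ∑-* : ∀ (xs : List A) k f → ∑ xs (λ x → k * f x) ≡ k * ∑ xs f
  ∑-* []       k f = sym (*-zeroʳ k)
  ∑-* (x ∷ xs) k f = trans (cong (_+_ (k * f x)) (∑-* xs k f)) (sym (*-distribˡ-+ k (f x) _))

  ∑-affine : ∀ (xs : List A) k l f → ∑ xs (λ x → k + l * f x) ≡ k * ∑ xs (λ _ → 1ℚ) + l * ∑ xs f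
  ∑-affine []       k l f = lemma k l
    where
    lemma : ∀ k l → 0ℚ ≡ k * 0ℚ + l * 0ℚ
    lemma = solve-∀ ℚ-ring
  ∑-affine (x ∷ xs) k l f = trans (cong (_+_ (k + l * f x)) (∑-affine xs k l f))
    (lemma k l (f x) (∑ xs (λ _ → 1ℚ)) (∑ xs f))
    where
    lemma : ∀ k l y s t → (k + l * y) + (k * s + l * t) ≡ k * (1ℚ + s) + l * (y + t)
    lemma = solve-∀ ℚ-ring

  ∑-approx : ∀ (xs : List A) f g h → (∀ x → ∣ f x - g x ∣ ≤ h x) → ∣ ∑ xs f - ∑ xs g ∣ ≤ ∑ xs h
  ∑-approx []       f g h le = ≤-refl
  ∑-approx (x ∷ xs) f g h le = subst (λ w → ∣ w ∣ ≤ h x + ∑ xs h) (lemma (f x) (g x) (∑ xs f) (∑ xs g))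
    (≤-trans (∣p+q∣≤∣p∣+∣q∣ (f x - g x) _) (+-mono-≤ (le x) (∑-approx xs f g h le)))
    where
    lemma : ∀ a b c d → (a - b) + (c - d) ≡ (a + c) - (b + d)
    lemma = solve-∀ ℚ-ring

  𝔼-length : ∀ (xs : List A) X → 𝔼 xs X * fromℕ (length xs) ≡ ∑ xs X
  𝔼-length []         X = refl
  𝔼-length xs@(_ ∷ _) X = trans (*-assoc (∑ xs X) (+ 1 / length xs) (fromℕ (length xs)))
    (trans (cong (∑ xs X *_) (/-*-cancel 1 (length xs))) (*-identityʳ (∑ xs X)))

∣affine∣-≤ : ∀ α β γ {u v} → 0ℚ ≤ u → u ≤ 1ℚ → 0ℚ ≤ v → v ≤ 1ℚ →
  ∣ α + v * β + u * γ ∣ ≤ ∣ α ∣ + ∣ β ∣ + ∣ γ ∣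
∣affine∣-≤ α β γ {u} {v} 0≤u u≤1 0≤v v≤1 =
  ≤-trans (∣p+q∣≤∣p∣+∣q∣ (α + v * β) (u * γ)) (+-mono-≤
    (≤-trans (∣p+q∣≤∣p∣+∣q∣ α (v * β)) (+-monoʳ-≤ ∣ α ∣ (scaled β 0≤v v≤1))) (scaled γ 0≤u u≤1))
  where
  scaled : ∀ β {v} → 0ℚ ≤ v → v ≤ 1ℚ → ∣ v * β ∣ ≤ ∣ β ∣
  scaled β {v} 0≤v v≤1 = subst₂ _≤_ (sym (trans (∣p*q∣≡∣p∣*∣q∣ v β) (cong (_* ∣ β ∣) (0≤p⇒∣p∣≡p 0≤v))))
    (*-identityˡ ∣ β ∣) (*-monoʳ (0≤∣p∣ β) v≤1)

-- Estimates for sums over parking functions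

infixl 6 _⟨+⟩_
infixl 7 _⟨*⟩_

-- A wrapper that keeps fromℕ from being unfolded during unification.
record Cast (k : ℕ) (x : ℚ) : Set where
  constructor cast
  field cast-≡ : fromℕ k ≡ x

open Cast

_⟨+⟩_ : ∀ {a b x y} → Cast a x → Cast b y → Cast (a ℕ.+ b) (x + y)
_⟨+⟩_ {a} {b} p q = cast (trans (fromℕ-+ a b) (cong₂ _+_ (cast-≡ p) (cast-≡ q)))

_⟨*⟩_ : ∀ {a b x y} → Cast a x → Cast b y → Cast (a ℕ.* b) (x * y)
_⟨*⟩_ {a} {b} p q = cast (trans (fromℕ-* a b) (cong₂ _*_ (cast-≡ p) (cast-≡ q)))

‵_ : ∀ a → Cast a (fromℕ a)
‵ a = cast refl

infix 8 ‵_

∑-PF : ∀ m n (g : List (Fin n) → ℕ) → ∑ (PF m n) (fromℕ ∘ g ∘ toList) ≡ fromℕ (sumFits m g)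
∑-PF m n g = trans (∑-fromℕ (PF m n) (g ∘ toList)) (cong fromℕ (sum-PF m n g))

fromℕ-length : ∀ {a} {A : Set a} (xs : List A) → fromℕ (length xs) ≡ ∑ xs (λ _ → 1ℚ)
fromℕ-length []       = refl
fromℕ-length (x ∷ xs) = trans (fromℕ-suc (length xs)) (cong (_+_ 1ℚ) (fromℕ-length xs))

𝔼-PF : ∀ m n (g : List (Fin n) → ℕ) X → (∀ π → X π ≡ g (toList π)) →
  𝔼 (PF m n) (fromℕ ∘ X) * fromℕ (countFits n m) ≡ fromℕ (sumFits m g)
𝔼-PF m n g X eq = trans
  (cong (𝔼 (PF m n) (fromℕ ∘ X) *_)
    (sym (trans (fromℕ-length (PF m n)) (∑-PF m n (λ _ → 1)))))
  (trans (𝔼-length (PF m n) (fromℕ ∘ X))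
    (trans (∑-cong (PF m n) (λ π → cong fromℕ (eq π))) (∑-PF m n g)))

-- An affine function of the gap is summed exactly by Σ 1 and Σ ℓ; only the quadratic error meets Σ
-- ℓ², for which a bound is enough.
gap-moments : ∀ n {M} → M ℕ.≤ n → (f : List (Fin n) → ℚ) → ∀ a b k →
  (∀ σ → ∣ f σ - (a + b * fromℕ (gap σ)) ∣ ≤ k * fromℕ (gap σ ℕ.* gap σ)) →
  ∣ ∑ (PF M n) (f ∘ toList) - (a * fromℕ (countFits n M) + b * fromℕ (suc n ℕ.^ M)) ∣
    ≤ k * fromℕ (doubleResolvent (suc n) M)
gap-moments n {M} M≤n f a b k le = subst₂ (λ x y → ∣ ∑ (PF M n) (f ∘ toList) - x ∣ ≤ y)
  (trans (∑-affine (PF M n) a b (fromℕ ∘ gap ∘ toList))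
    (cong₂ (λ x y → a * x + b * y) (∑-PF M n (λ _ → 1))
      (trans (∑-PF M n gap) (cong fromℕ (sumGap-1 n M≤n)))))
  (trans (∑-* (PF M n) k (λ π → fromℕ (gap (toList π) ℕ.* gap (toList π))))
    (cong (k *_) (trans (∑-PF M n (λ σ → gap σ ℕ.* gap σ)) (cong fromℕ (sumGap-2 n M≤n)))))
  (∑-approx (PF M n) (f ∘ toList) _ _ (le ∘ toList))

-- Here u = 1/n and i = 1/nᵖ. The coefficient 3 combines one p + 1 from the trapezoidal term with 2
-- (p + 1) from writing L = ℓ - 1.
powerSum-linear : ∀ p → 1 ℕ.≤ p → ∀ f L u i → 0ℚ ≤ u → 0ℚ ≤ i →
  fromℕ (f ℕ.+ L) * u ≡ 1ℚ → fromℕ ((f ℕ.+ L) ℕ.^ p) * i ≡ 1ℚ →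
  ∣ fromℕ 2 * fromℕ (suc p) * i * fromℕ (powerSum p f)
    - ((fromℕ 2 * fromℕ (f ℕ.+ L) + fromℕ 3 * fromℕ (suc p)) + - (fromℕ 2 * fromℕ (suc p)) * fromℕ (suc L)) ∣
    ≤ fromℕ (powerSumError p) * u * fromℕ (suc L ℕ.* suc L)
powerSum-linear p 1≤p f L u i 0≤u 0≤i nu≡1 Ni≡1 =
  subst (λ x → ∣ x ∣ ≤ K * u * w)
    (trans (regroup s n i S l) (cong (λ y → fromℕ 2 * s * i * S - ((fromℕ 2 * n + fromℕ 3 * s) + - (fromℕ 2 * s) * y))
      (sym (fromℕ-suc L))))
    (∣-∣-≤
      (subst₂ _≤_ scaled-sum (trans (*-distribˡ-+ (u * i) _ _) (cong₂ _+_ scaled-main scaled-error))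
        (*-monoˡ 0≤ui (subst₂ _≤_ (cast-≡ (cast-sum n′ 2 (suc p) S′ L N′))
          (cast-≡ (cast-main n′ 2 (suc p) N′ ⟨+⟩ cast-error (powerSumError p) w′ N′))
          (fromℕ-mono-≤ (powerSum-upper p 1≤p f L)))))
      (subst₂ _≤_ scaled-main (trans (*-distribˡ-+ (u * i) _ _) (cong₂ _+_ scaled-sum scaled-error))
        (*-monoˡ 0≤ui (subst₂ _≤_ (cast-≡ (cast-main n′ 2 (suc p) N′))
          (cast-≡ (cast-sum n′ 2 (suc p) S′ L N′ ⟨+⟩ cast-error (powerSumError p) w′ N′))
          (fromℕ-mono-≤ (powerSum-lower p 1≤p f L))))))
  where
  n′ = f ℕ.+ L
  N′ = n′ ℕ.^ p
  S′ = powerSum p f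
  w′ = suc L ℕ.* suc L
  n = fromℕ n′
  N = fromℕ N′
  S = fromℕ S′
  w = fromℕ w′
  l = fromℕ L
  s = fromℕ (suc p)
  K = fromℕ (powerSumError p)
  0≤ui : 0ℚ ≤ u * i
  0≤ui = 0≤* 0≤u 0≤i
  cast-sum : ∀ n t k S L N → Cast (n ℕ.* (t ℕ.* k ℕ.* S ℕ.+ t ℕ.* k ℕ.* L ℕ.* N))
    (fromℕ n * (fromℕ t * fromℕ k * fromℕ S + fromℕ t * fromℕ k * fromℕ L * fromℕ N))
  cast-sum n t k S L N = ‵ n ⟨*⟩ (‵ t ⟨*⟩ ‵ k ⟨*⟩ ‵ S ⟨+⟩ ‵ t ⟨*⟩ ‵ k ⟨*⟩ ‵ L ⟨*⟩ ‵ N)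
  cast-main : ∀ n t k N → Cast (n ℕ.* (t ℕ.* (n ℕ.* N) ℕ.+ k ℕ.* N))
    (fromℕ n * (fromℕ t * (fromℕ n * fromℕ N) + fromℕ k * fromℕ N))
  cast-main n t k N = ‵ n ⟨*⟩ (‵ t ⟨*⟩ (‵ n ⟨*⟩ ‵ N) ⟨+⟩ ‵ k ⟨*⟩ ‵ N)
  cast-error : ∀ k w N → Cast (k ℕ.* w ℕ.* N) (fromℕ k * fromℕ w * fromℕ N)
  cast-error k w N = ‵ k ⟨*⟩ ‵ w ⟨*⟩ ‵ N
  scaled-sum : u * i * (n * (fromℕ 2 * s * S + fromℕ 2 * s * l * N)) ≡ fromℕ 2 * s * i * S + fromℕ 2 * s * l
  scaled-sum = trans (lemma u i n s S l N) (trans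
    (cong₂ (λ x y → x * (fromℕ 2 * s * i * S + fromℕ 2 * s * l * y)) nu≡1 Ni≡1)
    (lemma′ (fromℕ 2 * s * i * S) (fromℕ 2 * s * l)))
    where
    lemma : ∀ u i n s S l N → u * i * (n * (fromℕ 2 * s * S + fromℕ 2 * s * l * N))
      ≡ (n * u) * (fromℕ 2 * s * i * S + fromℕ 2 * s * l * (N * i))
    lemma = solve-∀ ℚ-ring
    lemma′ : ∀ x y → 1ℚ * (x + y * 1ℚ) ≡ x + y
    lemma′ = solve-∀ ℚ-ring
  scaled-main : u * i * (n * (fromℕ 2 * (n * N) + s * N)) ≡ fromℕ 2 * n + s
  scaled-main = trans (lemma u i n s N) (trans
    (cong₂ (λ x y → x * (fromℕ 2 * n * y + s * y)) nu≡1 Ni≡1)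
    (lemma′ (fromℕ 2 * n) s))
    where
    lemma : ∀ u i n s N → u * i * (n * (fromℕ 2 * (n * N) + s * N))
      ≡ (n * u) * (fromℕ 2 * n * (N * i) + s * (N * i))
    lemma = solve-∀ ℚ-ring
    lemma′ : ∀ x y → 1ℚ * (x * 1ℚ + y * 1ℚ) ≡ x + y
    lemma′ = solve-∀ ℚ-ring
  scaled-error : u * i * (K * w * N) ≡ K * u * w
  scaled-error = trans (lemma u i K w N) (trans (cong (K * u * w *_) Ni≡1) (*-identityʳ (K * u * w)))
    where
    lemma : ∀ u i K w N → u * i * (K * w * N) ≡ K * u * w * (N * i)
    lemma = solve-∀ ℚ-ring
  regroup : ∀ s n i S l → (fromℕ 2 * s * i * S + fromℕ 2 * s * l) - (fromℕ 2 * n + s)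
    ≡ fromℕ 2 * s * i * S - ((fromℕ 2 * n + fromℕ 3 * s) + - (fromℕ 2 * s) * (1ℚ + l))
  regroup = solve-∀ ℚ-ring

powerSum-gap : ∀ p → 1 ℕ.≤ p → ∀ {n} u i → 0ℚ ≤ u → 0ℚ ≤ i →
  fromℕ n * u ≡ 1ℚ → fromℕ (n ℕ.^ p) * i ≡ 1ℚ → (σ : List (Fin n)) →
  ∣ fromℕ 2 * fromℕ (suc p) * i * fromℕ (powerSum p (lastFree σ))
    - ((fromℕ 2 * fromℕ n + fromℕ 3 * fromℕ (suc p)) + - (fromℕ 2 * fromℕ (suc p)) * fromℕ (gap σ)) ∣
    ≤ fromℕ (powerSumError p) * u * fromℕ (gap σ ℕ.* gap σ)
powerSum-gap p 1≤p {n} u i 0≤u 0≤i nu≡1 Ni≡1 σ = subst₂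
  (λ n ℓ → ∣ fromℕ 2 * fromℕ (suc p) * i * fromℕ (powerSum p f)
    - ((fromℕ 2 * fromℕ n + fromℕ 3 * fromℕ (suc p)) + - (fromℕ 2 * fromℕ (suc p)) * fromℕ ℓ) ∣
    ≤ fromℕ (powerSumError p) * u * fromℕ (ℓ ℕ.* ℓ))
  f+L≡n (sym (ℕ.+-∸-assoc 1 (lastFree≤n σ)))
  (powerSum-linear p 1≤p f (n ℕ.∸ f) u i 0≤u 0≤i
    (subst (λ n → fromℕ n * u ≡ 1ℚ) (sym f+L≡n) nu≡1)
    (subst (λ n → fromℕ (n ℕ.^ p) * i ≡ 1ℚ) (sym f+L≡n) Ni≡1))
  where
  f = lastFree σ
  f+L≡n : f ℕ.+ (n ℕ.∸ f) ≡ n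
  f+L≡n = ℕ.m+[n∸m]≡n (lastFree≤n σ)

-- With y = 3 - 2 ℓ the approximants are 2 n + s y and 2 n + s′ y. Their product is kept to first
-- order in y, and s s′ y² is at most 4 s s′ ℓ². In the mixed errors one factor is O(n), thanks to ℓ
-- ≤ n + 1 and the bound on b, and it cancels u = 1/n.
product-approx : ∀ a b s s′ n u K K′ ℓ → 0ℚ ≤ s → 0ℚ ≤ s′ → 0ℚ ≤ u → 0ℚ ≤ K → 0ℚ ≤ K′ →
  1 ℕ.≤ n → 1 ℕ.≤ ℓ → ℓ ℕ.≤ suc n → fromℕ n * u ≡ 1ℚ →
  ∣ a - ((fromℕ 2 * fromℕ n + fromℕ 3 * s) + - (fromℕ 2 * s) * fromℕ ℓ) ∣ ≤ K * u * fromℕ (ℓ ℕ.* ℓ) →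
  ∣ b - ((fromℕ 2 * fromℕ n + fromℕ 3 * s′) + - (fromℕ 2 * s′) * fromℕ ℓ) ∣ ≤ K′ * u * fromℕ (ℓ ℕ.* ℓ) →
  ∣ b ∣ ≤ fromℕ 2 * s′ * fromℕ n →
  ∣ a * b - ((fromℕ 4 * fromℕ n * fromℕ n + fromℕ 6 * fromℕ n * (s + s′)) + - (fromℕ 4 * fromℕ n * (s + s′)) * fromℕ ℓ) ∣
    ≤ (fromℕ 2 * s′ * K + (fromℕ 2 + fromℕ 2 * s) * K′ + fromℕ 4 * s * s′) * fromℕ (ℓ ℕ.* ℓ)
product-approx a b s s′ n′ u K K′ ℓ′ 0≤s 0≤s′ 0≤u 0≤K 0≤K′ 1≤n 1≤ℓ ℓ≤1+n nu≡1 a≈α b≈β b≤ =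
  subst₂ (λ x y → ∣ x ∣ ≤ y) (decompose a b s s′ n ℓ) total
    (≤-trans (∣p+q∣≤∣p∣+∣q∣ ((a - α) * b + α * (b - β)) (s * s′ * (y * y)))
      (+-mono-≤ (≤-trans (∣p+q∣≤∣p∣+∣q∣ ((a - α) * b) (α * (b - β)))
        (+-mono-≤ (∣*∣-≤ (a - α) b a≈α b≤) (∣*∣-≤ α (b - β) α≤ b≈β)))
        (∣*∣-≤ (s * s′) (y * y) (≤-reflexive (0≤p⇒∣p∣≡p (0≤* 0≤s 0≤s′))) (∣*∣-≤ y y y≤2ℓ y≤2ℓ))))
  where
  n = fromℕ n′
  ℓ = fromℕ ℓ′
  w = fromℕ (ℓ′ ℕ.* ℓ′)
  y = fromℕ 3 - fromℕ 2 * ℓ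
  α = (fromℕ 2 * n + fromℕ 3 * s) + - (fromℕ 2 * s) * ℓ
  β = (fromℕ 2 * n + fromℕ 3 * s′) + - (fromℕ 2 * s′) * ℓ
  cast-2 : ∀ t a b → Cast (t ℕ.* a ℕ.+ t ℕ.* b) (fromℕ t * fromℕ a + fromℕ t * fromℕ b)
  cast-2 t a b = ‵ t ⟨*⟩ ‵ a ⟨+⟩ ‵ t ⟨*⟩ ‵ b
  cast-3 : ∀ k t a → Cast (k ℕ.+ t ℕ.* a) (fromℕ k + fromℕ t * fromℕ a)
  cast-3 k t a = ‵ k ⟨+⟩ ‵ t ⟨*⟩ ‵ a
  cast-1 : ∀ t a → Cast (t ℕ.* a) (fromℕ t * fromℕ a)
  cast-1 t a = ‵ t ⟨*⟩ ‵ a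
  3≤2a+2b : ∀ {a b} → 1 ℕ.≤ a → 1 ℕ.≤ b → 3 ℕ.≤ 2 ℕ.* a ℕ.+ 2 ℕ.* b
  3≤2a+2b 1≤a 1≤b = ℕ.≤-trans (ℕ.n≤1+n 3) (ℕ.+-mono-≤ (ℕ.*-monoʳ-≤ 2 1≤a) (ℕ.*-monoʳ-≤ 2 1≤b))
  y≤2ℓ : ∣ y ∣ ≤ fromℕ 2 * ℓ
  y≤2ℓ = ∣-∣-≤
    (subst (fromℕ 3 ≤_) (cast-≡ (cast-2 2 ℓ′ ℓ′)) (fromℕ-mono-≤ (3≤2a+2b 1≤ℓ 1≤ℓ)))
    (subst₂ _≤_ (cast-≡ (cast-1 2 ℓ′)) (cast-≡ (cast-3 3 2 ℓ′)) (fromℕ-mono-≤ (ℕ.m≤n+m (2 ℕ.* ℓ′) 3)))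
  y≤2n : ∣ y ∣ ≤ fromℕ 2 * n
  y≤2n = ∣-∣-≤
    (subst (fromℕ 3 ≤_) (cast-≡ (cast-2 2 ℓ′ n′)) (fromℕ-mono-≤ (3≤2a+2b 1≤ℓ 1≤n)))
    (subst₂ _≤_ (cast-≡ (cast-1 2 ℓ′)) (cast-≡ (cast-3 3 2 n′)) (fromℕ-mono-≤
      (ℕ.≤-trans (ℕ.*-monoʳ-≤ 2 ℓ≤1+n) (ℕ.≤-trans (ℕ.≤-reflexive (ℕ.*-suc 2 n′)) (ℕ.n≤1+n _)))))
  α≤ : ∣ α ∣ ≤ (fromℕ 2 + fromℕ 2 * s) * n
  α≤ = subst₂ (λ x z → ∣ x ∣ ≤ z) (lemma₁ n s ℓ) (lemma₂ n s)
    (≤-trans (∣p+q∣≤∣p∣+∣q∣ (fromℕ 2 * n) (s * y)) (+-mono-≤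
      (≤-reflexive (0≤p⇒∣p∣≡p (0≤* (0≤fromℕ 2) (0≤fromℕ n′))))
      (∣*∣-≤ s y (≤-reflexive (0≤p⇒∣p∣≡p 0≤s)) y≤2n)))
    where
    lemma₁ : ∀ n s ℓ → fromℕ 2 * n + s * (fromℕ 3 - fromℕ 2 * ℓ) ≡ (fromℕ 2 * n + fromℕ 3 * s) + - (fromℕ 2 * s) * ℓ
    lemma₁ = solve-∀ ℚ-ring
    lemma₂ : ∀ n s → fromℕ 2 * n + s * (fromℕ 2 * n) ≡ (fromℕ 2 + fromℕ 2 * s) * n
    lemma₂ = solve-∀ ℚ-ring
  decompose : ∀ a b s s′ n ℓ →
    ((a - ((fromℕ 2 * n + fromℕ 3 * s) + - (fromℕ 2 * s) * ℓ)) * b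
      + ((fromℕ 2 * n + fromℕ 3 * s) + - (fromℕ 2 * s) * ℓ) * (b - ((fromℕ 2 * n + fromℕ 3 * s′) + - (fromℕ 2 * s′) * ℓ)))
      + s * s′ * ((fromℕ 3 - fromℕ 2 * ℓ) * (fromℕ 3 - fromℕ 2 * ℓ))
    ≡ a * b - ((fromℕ 4 * n * n + fromℕ 6 * n * (s + s′)) + - (fromℕ 4 * n * (s + s′)) * ℓ)
  decompose = solve-∀ ℚ-ring
  total : (K * u * w * (fromℕ 2 * s′ * n) + (fromℕ 2 + fromℕ 2 * s) * n * (K′ * u * w))
      + s * s′ * (fromℕ 2 * ℓ * (fromℕ 2 * ℓ))
    ≡ (fromℕ 2 * s′ * K + (fromℕ 2 + fromℕ 2 * s) * K′ + fromℕ 4 * s * s′) * w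
  total = trans (lemma₁ K K′ s s′ n u ℓ w) (trans
    (cong₂ (λ x z → x * ((fromℕ 2 * s′ * K + (fromℕ 2 + fromℕ 2 * s) * K′) * w) + fromℕ 4 * s * s′ * z)
      nu≡1 (sym (fromℕ-* ℓ′ ℓ′)))
    (lemma₂ (fromℕ 2 * s′ * K + (fromℕ 2 + fromℕ 2 * s) * K′) (fromℕ 4 * s * s′) w))
    where
    lemma₁ : ∀ K K′ s s′ n u ℓ w →
      (K * u * w * (fromℕ 2 * s′ * n) + (fromℕ 2 + fromℕ 2 * s) * n * (K′ * u * w))
        + s * s′ * (fromℕ 2 * ℓ * (fromℕ 2 * ℓ))
      ≡ (n * u) * ((fromℕ 2 * s′ * K + (fromℕ 2 + fromℕ 2 * s) * K′) * w) + fromℕ 4 * s * s′ * (ℓ * ℓ)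
    lemma₁ = solve-∀ ℚ-ring
    lemma₂ : ∀ x z w → 1ℚ * (x * w) + z * w ≡ (x + z) * w
    lemma₂ = solve-∀ ℚ-ring

0≤1/ : ∀ n .{{_ : ℕ.NonZero n}} → 0ℚ ≤ + 1 / n
0≤1/ n = nonNegative⁻¹ (+ 1 / n) {{normalize-nonNeg 1 n}}

n*1/n≡1 : ∀ n .{{_ : ℕ.NonZero n}} → fromℕ n * (+ 1 / n) ≡ 1ℚ
n*1/n≡1 n = trans (*-comm (fromℕ n) (+ 1 / n)) (/-*-cancel 1 n)

0<fromℕ : ∀ n .{{_ : ℕ.NonZero n}} → 0ℚ < fromℕ n
0<fromℕ n = fromℕ-mono-< {0} {n} (ℕ.>-nonZero⁻¹ n)

1/n≤1 : ∀ n .{{_ : ℕ.NonZero n}} → + 1 / n ≤ 1ℚ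
1/n≤1 n = *-cancelˡ (0<fromℕ n) (subst₂ _≤_ (sym (n*1/n≡1 n)) (sym (*-identityʳ (fromℕ n)))
  (fromℕ-mono-≤ {1} {n} (ℕ.>-nonZero⁻¹ n)))

-- Normalising count, second moment and quotient

-- Here d n + e = n + 1 − M.
module _ (n M : ℕ) (M≤n : M ℕ.≤ n) (d e : ℚ)
         (surplus : fromℕ (suc n) ≡ fromℕ M + (d * fromℕ n + e)) where

  private
    N Q Z U : ℚ
    N = fromℕ (suc n)
    Q = fromℕ (suc n ℕ.^ M)
    Z = fromℕ (countFits n M)
    U = fromℕ (doubleResolvent (suc n) M)

    surplus′ : d * fromℕ n + e ≡ d * N + (e - d)
    surplus′ = sym (trans (cong (λ x → d * x + (e - d)) (fromℕ-suc n)) (lemma d e (fromℕ n)))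
      where
      lemma : ∀ d e n → d * (1ℚ + n) + (e - d) ≡ d * n + e
      lemma = solve-∀ ℚ-ring

  -- The count is Q (N - M) / N, and N - M = d N + (e - d) separates the limiting density d from its
  -- correction of order 1/N.
  countFits-ratio : ∀ v → N * v ≡ 1ℚ → Z ≡ Q * (d + (e - d) * v)
  countFits-ratio v Nv≡1 = begin
    Z                                              ≡⟨ sym (trans (cong (Z *_) Nv≡1) (*-identityʳ Z)) ⟩
    Z * (N * v)                                    ≡⟨ lemma₁ Z N v (fromℕ M) Q ⟩
    (Z * N + fromℕ M * Q) * v - fromℕ M * Q * v    ≡⟨ cong (λ x → x * v - fromℕ M * Q * v) balance ⟩
    N * Q * v - fromℕ M * Q * v                    ≡⟨ cong (λ x → x * Q * v - fromℕ M * Q * v) surplus ⟩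
    (fromℕ M + (d * fromℕ n + e)) * Q * v - fromℕ M * Q * v ≡⟨ lemma₂ (fromℕ M) (d * fromℕ n + e) Q v ⟩
    Q * ((d * fromℕ n + e) * v)                    ≡⟨ cong (λ x → Q * (x * v)) surplus′ ⟩
    Q * ((d * N + (e - d)) * v)                    ≡⟨ lemma₃ Q d N e v ⟩
    Q * (d * (N * v) + (e - d) * v)                ≡⟨ cong (λ x → Q * (d * x + (e - d) * v)) Nv≡1 ⟩
    Q * (d * 1ℚ + (e - d) * v)                     ≡⟨ cong (λ x → Q * (x + (e - d) * v)) (*-identityʳ d) ⟩
    Q * (d + (e - d) * v)                          ∎
    where
    open ≡-Reasoning
    balance : Z * N + fromℕ M * Q ≡ N * Q
    balance = trans (sym (cast-≡ (‵ countFits n M ⟨*⟩ ‵ suc n ⟨+⟩ ‵ M ⟨*⟩ ‵ (suc n ℕ.^ M))))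
      (trans (cong fromℕ (countFits-suc n M M≤n)) (cast-≡ (‵ suc n ⟨*⟩ ‵ (suc n ℕ.^ M))))
    lemma₁ : ∀ z N v m q → z * (N * v) ≡ (z * N + m * q) * v - m * q * v
    lemma₁ = solve-∀ ℚ-ring
    lemma₂ : ∀ m x q v → (m + x) * q * v - m * q * v ≡ q * (x * v)
    lemma₂ = solve-∀ ℚ-ring
    lemma₃ : ∀ q d N e v → q * ((d * N + (e - d)) * v) ≡ q * (d * (N * v) + (e - d) * v)
    lemma₃ = solve-∀ ℚ-ring

  -- A fixed density below 1 enters here: `d ≤ e` gives N - M ≥ d N, so each of the two geometric
  -- series in the double resolvent costs at most a factor r = 1/d.
  secondMoment-bound : ∀ r → 0ℚ ≤ d → d ≤ e → d * r ≡ 1ℚ → 0ℚ ≤ r → U ≤ Q * (r * r)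
  secondMoment-bound r 0≤d d≤e dr≡1 0≤r = subst₂ _≤_ restore (*-comm (r * r) Q)
    (*-monoˡ (0≤* 0≤r 0≤r) ddU≤Q)
    where
    D = suc n ℕ.∸ M
    D≡ : fromℕ D ≡ d * fromℕ n + e
    D≡ = begin
      fromℕ D                                          ≡⟨ lemma (fromℕ M) (fromℕ D) ⟩
      (fromℕ M + fromℕ D) - fromℕ M                    ≡⟨ cong (_- fromℕ M) (sym (fromℕ-+ M D)) ⟩
      fromℕ (M ℕ.+ D) - fromℕ M                        ≡⟨ cong (λ x → fromℕ x - fromℕ M) (ℕ.m+[n∸m]≡n (ℕ.m≤n⇒m≤1+n M≤n)) ⟩
      N - fromℕ M                                      ≡⟨ cong (_- fromℕ M) surplus ⟩
      (fromℕ M + (d * fromℕ n + e)) - fromℕ M          ≡⟨ sym (lemma (fromℕ M) (d * fromℕ n + e)) ⟩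
      d * fromℕ n + e                                  ∎
      where
      open ≡-Reasoning
      lemma : ∀ m x → x ≡ (m + x) - m
      lemma = solve-∀ ℚ-ring
    dN≤D : d * N ≤ fromℕ D
    dN≤D = subst (d * N ≤_) (sym (trans D≡ surplus′))
      (x≤x+y (subst (_≤ e - d) (+-inverseʳ d) (+-monoˡ-≤ (- d) d≤e)))
    0≤dN : 0ℚ ≤ d * N
    0≤dN = 0≤* 0≤d (0≤fromℕ (suc n))
    0≤D = 0≤fromℕ D
    0≤U = 0≤fromℕ (doubleResolvent (suc n) M)
    DDU≤NNQ : fromℕ D * fromℕ D * U ≤ N * N * Q
    DDU≤NNQ = subst₂ _≤_ (cast-≡ (‵ D ⟨*⟩ ‵ D ⟨*⟩ ‵ doubleResolvent (suc n) M))
      (cast-≡ (‵ suc n ⟨*⟩ ‵ suc n ⟨*⟩ ‵ (suc n ℕ.^ M)))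
      (fromℕ-mono-≤ (doubleResolvent-bound (suc n) D M (ℕ.≤-reflexive (ℕ.m+[n∸m]≡n (ℕ.m≤n⇒m≤1+n M≤n)))))
    ddU≤Q : d * d * U ≤ Q
    ddU≤Q = *-cancelˡ (0<* (0<fromℕ (suc n)) (0<fromℕ (suc n)))
      (subst (_≤ N * N * Q) (lemma d N U)
        (≤-trans (*-monoʳ 0≤U (*-mono 0≤dN 0≤D dN≤D dN≤D)) DDU≤NNQ))
      where
      lemma : ∀ d N U → d * N * (d * N) * U ≡ N * N * (d * d * U)
      lemma = solve-∀ ℚ-ring
    restore : r * r * (d * d * U) ≡ U
    restore = trans (lemma r d U) (trans (cong (λ x → x * x * U) dr≡1) (*-identityˡ U))
      where
      lemma : ∀ r d U → r * r * (d * d * U) ≡ (d * r) * (d * r) * U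
      lemma = solve-∀ ℚ-ring

-- B is the scale of the error in the numerator: Q/n for one car and Q for two. Up to the factor d
-- it is at most P/n², which yields the relative error 1/n².
quotient-bound : ∀ t V P κ u K B d r → 0ℚ < P → t * P ≡ V →
  0ℚ ≤ K → 0ℚ ≤ r → d * r ≡ 1ℚ → B * d ≤ P * (u * u) →
  ∣ V - P * (1ℚ + u * κ) ∣ ≤ B * K → ∣ t - (1ℚ + u * κ) ∣ ≤ K * r * u * u
quotient-bound t V P κ u K B d r 0<P tP≡V 0≤K 0≤r dr≡1 Bd≤ error = *-cancelˡ 0<P (begin
  P * ∣ t - y ∣          ≡⟨ cong (_* ∣ t - y ∣) (sym (0≤p⇒∣p∣≡p (<⇒≤ 0<P))) ⟩
  ∣ P ∣ * ∣ t - y ∣      ≡⟨ sym (∣p*q∣≡∣p∣*∣q∣ P (t - y)) ⟩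
  ∣ P * (t - y) ∣        ≡⟨ cong ∣_∣ (trans (lemma₁ P t y) (cong (_- P * y) tP≡V)) ⟩
  ∣ V - P * y ∣          ≤⟨ error ⟩
  B * K                  ≡⟨ sym (trans (cong (B * K *_) dr≡1) (*-identityʳ (B * K))) ⟩
  B * K * (d * r)        ≡⟨ lemma₂ B K d r ⟩
  B * d * (K * r)        ≤⟨ *-monoʳ (0≤* 0≤K 0≤r) Bd≤ ⟩
  P * (u * u) * (K * r)  ≡⟨ lemma₃ P u K r ⟩
  P * (K * r * u * u)    ∎)
  where
  open ≤-Reasoning
  y = 1ℚ + u * κ
  lemma₁ : ∀ P t y → P * (t - y) ≡ t * P - P * y
  lemma₁ = solve-∀ ℚ-ring
  lemma₂ : ∀ B K d r → B * K * (d * r) ≡ B * d * (K * r)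
  lemma₂ = solve-∀ ℚ-ring
  lemma₃ : ∀ P u K r → P * (u * u) * (K * r) ≡ P * (K * r * u * u)
  lemma₃ = solve-∀ ℚ-ring

-- First-order expansion of the main terms

-- In the two expansions u = 1/n, v = 1/(n + 1) and κ is the correction of order
-- 1/n; the equation for κ makes the leading terms cancel.
oneCar-α : ℚ → ℚ → ℚ
oneCar-α d s = (fromℕ 2 - d) * (fromℕ 3 * s - fromℕ 2)

oneCar-expansion : ∀ n s Q d v u κ → n * u ≡ 1ℚ → n * v ≡ 1ℚ - v →
  fromℕ 2 * (d * κ) ≡ d * s - fromℕ 2 * ((1ℚ - d) * (s - 1ℚ)) →
  ((fromℕ 2 * n + fromℕ 3 * s) * (Q * (d + (fromℕ 2 - d) * v)) + - (fromℕ 2 * s) * Q)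
    - fromℕ 2 * (Q * (d * n + 1ℚ)) * (1ℚ + u * κ)
  ≡ Q * u * ((oneCar-α d s - fromℕ 2 * κ) + v * (- oneCar-α d s) + u * 0ℚ)
oneCar-expansion n s Q d v u κ nu≡1 nv≡1-v 2dκ≡ = begin
  ((fromℕ 2 * n + fromℕ 3 * s) * (Q * (d + (fromℕ 2 - d) * v)) + - (fromℕ 2 * s) * Q)
    - fromℕ 2 * (Q * (d * n + 1ℚ)) * (1ℚ + u * κ)
    ≡⟨ lemma₁ n s Q d v u κ ⟩
  G (n * v) (n * u) (fromℕ 2 * (d * κ))
    ≡⟨ trans (cong (λ x → G x (n * u) (fromℕ 2 * (d * κ))) nv≡1-v) (cong₂ (G (1ℚ - v)) nu≡1 2dκ≡) ⟩
  G (1ℚ - v) 1ℚ (d * s - fromℕ 2 * ((1ℚ - d) * (s - 1ℚ)))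
    -- As P has order Q n, the terms of order Q n and of order Q both have to cancel; multiples of Q
    -- v and Q u remain.
    ≡⟨ lemma₂ n s Q d v u κ ⟩
  Q * (v * oneCar-α d s - u * (fromℕ 2 * κ))
    -- 1/(n + 1) = (1/n) (1 - 1/(n + 1)) extracts a factor u from the terms with v.
    ≡⟨ cong (λ x → Q * (x * oneCar-α d s - u * (fromℕ 2 * κ))) v≡u[1-v] ⟩
  Q * (u * (1ℚ - v) * oneCar-α d s - u * (fromℕ 2 * κ))
    ≡⟨ lemma₃ Q u v (oneCar-α d s) (fromℕ 2 * κ) ⟩
  Q * u * ((oneCar-α d s - fromℕ 2 * κ) + v * (- oneCar-α d s) + u * 0ℚ) ∎
  where
  open ≡-Reasoning
  G : ℚ → ℚ → ℚ → ℚ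
  G x y w = Q * (fromℕ 2 * n * d + fromℕ 2 * (fromℕ 2 - d) * x + fromℕ 3 * s * (d + (fromℕ 2 - d) * v)
    - fromℕ 2 * s - fromℕ 2 * d * n - fromℕ 2 - y * w - fromℕ 2 * u * κ)
  v≡u[1-v] : v ≡ u * (1ℚ - v)
  v≡u[1-v] = trans (sym (*-identityˡ v)) (trans (cong (_* v) (sym nu≡1))
    (trans (lemma n u v) (cong (u *_) nv≡1-v)))
    where
    lemma : ∀ n u v → n * u * v ≡ u * (n * v)
    lemma = solve-∀ ℚ-ring
  lemma₁ : ∀ n s Q d v u κ →
    ((fromℕ 2 * n + fromℕ 3 * s) * (Q * (d + (fromℕ 2 - d) * v)) + - (fromℕ 2 * s) * Q)
      - fromℕ 2 * (Q * (d * n + 1ℚ)) * (1ℚ + u * κ)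
    ≡ Q * (fromℕ 2 * n * d + fromℕ 2 * (fromℕ 2 - d) * (n * v) + fromℕ 3 * s * (d + (fromℕ 2 - d) * v)
      - fromℕ 2 * s - fromℕ 2 * d * n - fromℕ 2 - (n * u) * (fromℕ 2 * (d * κ)) - fromℕ 2 * u * κ)
  lemma₁ = solve-∀ ℚ-ring
  lemma₂ : ∀ n s Q d v u κ →
    Q * (fromℕ 2 * n * d + fromℕ 2 * (fromℕ 2 - d) * (1ℚ - v) + fromℕ 3 * s * (d + (fromℕ 2 - d) * v)
      - fromℕ 2 * s - fromℕ 2 * d * n - fromℕ 2 - 1ℚ * (d * s - fromℕ 2 * ((1ℚ - d) * (s - 1ℚ))) - fromℕ 2 * u * κ)
    ≡ Q * (v * ((fromℕ 2 - d) * (fromℕ 3 * s - fromℕ 2)) - u * (fromℕ 2 * κ))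
  lemma₂ = solve-∀ ℚ-ring
  lemma₃ : ∀ Q u v α k → Q * (u * (1ℚ - v) * α - u * k) ≡ Q * u * ((α - k) + v * (- α) + u * 0ℚ)
  lemma₃ = solve-∀ ℚ-ring

twoCar-β : ℚ → ℚ → ℚ
twoCar-β d s = (fromℕ 3 - d) * (fromℕ 4 - fromℕ 6 * s)

-- P now has order Q n², so it suffices that the terms of order Q n² and Q n cancel; a bounded
-- multiple of Q may remain.
twoCar-expansion : ∀ n s Q d v u κ → n * u ≡ 1ℚ → n * v ≡ 1ℚ - v →
  fromℕ 2 * (d * κ) ≡ d * s - fromℕ 2 * ((1ℚ - d) * (s - fromℕ 2)) →
  ((fromℕ 4 * n * n + fromℕ 6 * n * s) * (Q * (d + (fromℕ 3 - d) * v)) + - (fromℕ 4 * n * s) * Q)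
    - fromℕ 4 * (Q * ((1ℚ + n) * (d * n + 1ℚ))) * (1ℚ + u * κ)
  ≡ Q * ((- twoCar-β d s - fromℕ 4 - fromℕ 4 * (d + 1ℚ) * κ) + v * twoCar-β d s + u * (- (fromℕ 4 * κ)))
twoCar-expansion n s Q d v u κ nu≡1 nv≡1-v 2dκ≡ = begin
  ((fromℕ 4 * n * n + fromℕ 6 * n * s) * (Q * (d + (fromℕ 3 - d) * v)) + - (fromℕ 4 * n * s) * Q)
    - fromℕ 4 * (Q * ((1ℚ + n) * (d * n + 1ℚ))) * (1ℚ + u * κ)
    ≡⟨ lemma₁ n s Q d v u κ ⟩
  G (n * (n * v)) (n * v) (n * u) (fromℕ 2 * (d * κ))
    ≡⟨ trans (cong₂ (λ x y → G x y (n * u) (fromℕ 2 * (d * κ))) nnv≡ nv≡1-v)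
             (cong₂ (G (n - (1ℚ - v)) (1ℚ - v)) nu≡1 2dκ≡) ⟩
  G (n - (1ℚ - v)) (1ℚ - v) 1ℚ (d * s - fromℕ 2 * ((1ℚ - d) * (s - fromℕ 2)))
    ≡⟨ lemma₂ n s Q d v u κ ⟩
  Q * ((- twoCar-β d s - fromℕ 4 - fromℕ 4 * (d + 1ℚ) * κ) + v * twoCar-β d s + u * (- (fromℕ 4 * κ))) ∎
  where
  open ≡-Reasoning
  G : ℚ → ℚ → ℚ → ℚ → ℚ
  G x x′ y w = Q * (fromℕ 4 * n * n * d + fromℕ 4 * (fromℕ 3 - d) * x + fromℕ 6 * n * s * d
    + fromℕ 6 * s * (fromℕ 3 - d) * x′ - fromℕ 4 * n * s - fromℕ 4 * (d * n * n + d * n + n + 1ℚ)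
    - fromℕ 2 * n * y * w - fromℕ 4 * (d + 1ℚ) * κ * y - fromℕ 4 * u * κ)
  nnv≡ : n * (n * v) ≡ n - (1ℚ - v)
  nnv≡ = trans (cong (n *_) nv≡1-v) (trans (lemma n v) (cong (_-_ n) nv≡1-v))
    where
    lemma : ∀ n v → n * (1ℚ - v) ≡ n - n * v
    lemma = solve-∀ ℚ-ring
  lemma₁ : ∀ n s Q d v u κ →
    ((fromℕ 4 * n * n + fromℕ 6 * n * s) * (Q * (d + (fromℕ 3 - d) * v)) + - (fromℕ 4 * n * s) * Q)
      - fromℕ 4 * (Q * ((1ℚ + n) * (d * n + 1ℚ))) * (1ℚ + u * κ)
    ≡ Q * (fromℕ 4 * n * n * d + fromℕ 4 * (fromℕ 3 - d) * (n * (n * v)) + fromℕ 6 * n * s * d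
      + fromℕ 6 * s * (fromℕ 3 - d) * (n * v) - fromℕ 4 * n * s - fromℕ 4 * (d * n * n + d * n + n + 1ℚ)
      - fromℕ 2 * n * (n * u) * (fromℕ 2 * (d * κ)) - fromℕ 4 * (d + 1ℚ) * κ * (n * u) - fromℕ 4 * u * κ)
  lemma₁ = solve-∀ ℚ-ring
  lemma₂ : ∀ n s Q d v u κ →
    Q * (fromℕ 4 * n * n * d + fromℕ 4 * (fromℕ 3 - d) * (n - (1ℚ - v)) + fromℕ 6 * n * s * d
      + fromℕ 6 * s * (fromℕ 3 - d) * (1ℚ - v) - fromℕ 4 * n * s - fromℕ 4 * (d * n * n + d * n + n + 1ℚ)
      - fromℕ 2 * n * 1ℚ * (d * s - fromℕ 2 * ((1ℚ - d) * (s - fromℕ 2))) - fromℕ 4 * (d + 1ℚ) * κ * 1ℚ - fromℕ 4 * u * κ)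
    ≡ Q * ((- ((fromℕ 3 - d) * (fromℕ 4 - fromℕ 6 * s)) - fromℕ 4 - fromℕ 4 * (d + 1ℚ) * κ)
      + v * ((fromℕ 3 - d) * (fromℕ 4 - fromℕ 6 * s)) + u * (- (fromℕ 4 * κ)))
  lemma₂ = solve-∀ ℚ-ring

-- The correction of the theorem, multiplied by 2 (1 - c) to clear its denominators. Writing c as 1
-- - (1 - c) matches the form in which the expansions use d.
correction-eq : ∀ c r h s k → (1ℚ - c) * r ≡ 1ℚ → h * fromℕ 2 ≡ s →
  fromℕ 2 * ((1ℚ - c) * (h - c * k * r)) ≡ (1ℚ - c) * s - fromℕ 2 * ((1ℚ - (1ℚ - c)) * k)
correction-eq c r h s k dr≡1 2h≡s = trans (lemma₁ c r h k) (trans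
  (cong₂ (λ x y → (1ℚ - c) * x - fromℕ 2 * (c * k) * y) 2h≡s dr≡1) (lemma₂ c s k))
  where
  lemma₁ : ∀ c r h k → fromℕ 2 * ((1ℚ - c) * (h - c * k * r))
    ≡ (1ℚ - c) * (h * fromℕ 2) - fromℕ 2 * (c * k) * ((1ℚ - c) * r)
  lemma₁ = solve-∀ ℚ-ring
  lemma₂ : ∀ c s k → (1ℚ - c) * s - fromℕ 2 * (c * k) * 1ℚ ≡ (1ℚ - c) * s - fromℕ 2 * ((1ℚ - (1ℚ - c)) * k)
  lemma₂ = solve-∀ ℚ-ring

-- The witness is the denominator of c: multiplied by it, c becomes its numerator, a positive
-- integer.
archimedean : ∀ c → Positive c → ∃[ b ] 1ℚ ≤ c * fromℕ b
archimedean c@(mkℚ +[1+ a ] b _) _ = suc b , subst (1ℚ ≤_)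
  (sym (trans (cong (_* fromℕ (suc b)) (sym (↥p/↧p≡p c))) (/-*-cancel (suc a) (suc b))))
  (fromℕ-mono-≤ {1} {suc a} (ℕ.s≤s ℕ.z≤n))

-- The two expectations

firstPower : ∀ {n} → ℕ → List (Fin n) → ℕ
firstPower p []      = 0
firstPower p (i ∷ _) = suc (toℕ i) ℕ.^ p

firstTwoPower : ∀ {n} → ℕ → ℕ → List (Fin n) → ℕ
firstTwoPower p q (i ∷ j ∷ _) = suc (toℕ i) ℕ.^ p ℕ.* suc (toℕ j) ℕ.^ q
firstTwoPower p q _           = 0

-- The error ε is taken to be the exact discrepancy `E * x - y`, so the equation is an identity and
-- only the size of ε needs an estimate.
expand-expectation : ∀ E C x y → C * x ≡ 1ℚ → E ≡ C * (y + (E * x - y))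
expand-expectation E C x y Cx≡1 = trans (trans (sym (*-identityʳ E)) (cong (E *_) (sym Cx≡1))) (lemma E C x y)
  where
  lemma : ∀ E C x y → E * (C * x) ≡ C * (y + (E * x - y))
  lemma = solve-∀ ℚ-ring

n*1/[1+n]≡ : ∀ n → fromℕ n * (+ 1 / suc n) ≡ 1ℚ - + 1 / suc n
n*1/[1+n]≡ n = trans (lemma (fromℕ n) v) (cong (_- v)
  (trans (cong (_* v) (sym (fromℕ-suc n))) (n*1/n≡1 (suc n))))
  where
  v = + 1 / suc n
  lemma : ∀ n v → n * v ≡ (1ℚ + n) * v - v
  lemma = solve-∀ ℚ-ring

module _ (c : ℚ) (0<c : 0ℚ < c) (c<1 : c < 1ℚ) where

  private
    d r : ℚ
    d = 1ℚ - c
    r = (1/ d) {{1-c≢0 c<1}}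

    dr≡1 : d * r ≡ 1ℚ
    dr≡1 = *-inverseʳ d {{1-c≢0 c<1}}

    0<d : 0ℚ < d
    0<d = subst (_< d) (+-inverseʳ c) (+-monoˡ-< (- c) c<1)

    0≤d : 0ℚ ≤ d
    0≤d = <⇒≤ 0<d

    d≤1 : d ≤ 1ℚ
    d≤1 = subst (d ≤_) (+-identityʳ 1ℚ) (+-monoʳ-≤ 1ℚ (neg-antimono-≤ (<⇒≤ 0<c)))

    0≤r : 0ℚ ≤ r
    0≤r = <⇒≤ (positive⁻¹ r {{1/pos⇒pos d {{positive 0<d}}}})

    m<n : ∀ n m .{{_ : ℕ.NonZero n}} → fromℕ m ≡ c * fromℕ n → m ℕ.< n
    m<n n m m≡cn = fromℕ-cancel-< (subst₂ _<_ (sym m≡cn) (*-identityˡ (fromℕ n))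
      (*-monoˡ-<-pos (fromℕ n) {{positive (0<fromℕ n)}} c<1))

    -- k of the c n cars are split off from σ, which makes the constant e equal to k + 1: 2 for one
    -- car, 3 for two.
    surplus-eq : ∀ n M k → fromℕ (k ℕ.+ M) ≡ c * fromℕ n →
      fromℕ (suc n) ≡ fromℕ M + (d * fromℕ n + fromℕ (suc k))
    surplus-eq n M k k+M≡cn = trans (fromℕ-suc n) (sym (trans
      (cong (λ x → fromℕ M + (d * fromℕ n + x)) (fromℕ-suc k)) (trans
      (lemma₁ c (fromℕ M) (fromℕ n) (fromℕ k)) (trans
      (cong (λ x → x - c * fromℕ n + fromℕ n + 1ℚ) (trans (sym (fromℕ-+ k M)) k+M≡cn))
      (lemma₂ (c * fromℕ n) (fromℕ n))))))
      where
      lemma₁ : ∀ c M n k → M + ((1ℚ - c) * n + (1ℚ + k)) ≡ (k + M) - c * n + n + 1ℚ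
      lemma₁ = solve-∀ ℚ-ring
      lemma₂ : ∀ x n → x - x + n + 1ℚ ≡ 1ℚ + n
      lemma₂ = solve-∀ ℚ-ring

  module OneCar (p : ℕ) (1≤p : 1 ℕ.≤ p) where

    κ s K₀ R K₁ : ℚ
    κ  = (+ suc p / 2) - _÷_ (c * fromℕ p) d {{1-c≢0 c<1}}
    s  = fromℕ (suc p)
    K₀ = fromℕ (powerSumError p)
    R  = ∣ oneCar-α d s - fromℕ 2 * κ ∣ + ∣ - oneCar-α d s ∣ + ∣ 0ℚ ∣
    -- The first summand bounds the linearisation error through the second moment, the second the
    -- remainder of `oneCar-expansion`.
    K₁ = K₀ * (r * r) + R

    2dκ≡ : fromℕ 2 * (d * κ) ≡ d * s - fromℕ 2 * ((1ℚ - d) * (s - 1ℚ))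
    2dκ≡ = trans (correction-eq c r (+ suc p / 2) s (fromℕ p) dr≡1 (/-*-cancel (suc p) 2))
      (cong (λ x → d * s - fromℕ 2 * ((1ℚ - d) * x))
        (sym (trans (cong (_- 1ℚ) (fromℕ-suc p)) (lemma (fromℕ p)))))
      where
      lemma : ∀ x → (1ℚ + x) - 1ℚ ≡ x
      lemma = solve-∀ ℚ-ring

    0≤K₁ : 0ℚ ≤ K₁
    0≤K₁ = 0≤+ (0≤* (0≤fromℕ (powerSumError p)) (0≤* 0≤r 0≤r))
      (0≤+ (0≤+ (0≤∣p∣ (oneCar-α d s - fromℕ 2 * κ)) (0≤∣p∣ (- oneCar-α d s))) (0≤∣p∣ 0ℚ))

    module _ (n M : ℕ) .{{_ : ℕ.NonZero n}} (1+M≡cn : fromℕ (suc M) ≡ c * fromℕ n) where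

      private
        instance
          n^p≢0 : ℕ.NonZero (n ℕ.^ p)
          n^p≢0 = ℕ.m^n≢0 n p

        M≤n : M ℕ.≤ n
        M≤n = ℕ.<⇒≤ (ℕ.<-trans (ℕ.n<1+n M) (m<n n (suc M) 1+M≡cn))

        n̂ u v i Q Z U P E A V B : ℚ
        n̂ = fromℕ n
        u = + 1 / n
        v = + 1 / suc n
        i = + 1 / (n ℕ.^ p)
        Q = fromℕ (suc n ℕ.^ M)
        Z = fromℕ (countFits n M)
        U = fromℕ (doubleResolvent (suc n) M)
        P = fromℕ (countFits n (suc M))
        E = 𝔼 (PF (suc M) n) (λ π → fromℕ (pref 0 (ℕ.s≤s ℕ.z≤n) π ℕ.^ p))
        A = fromℕ (sumFits M (λ (σ : List (Fin n)) → powerSum p (lastFree σ)))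
        V = fromℕ 2 * s * i * A
        B = Q * u

        nu≡1 : n̂ * u ≡ 1ℚ
        nu≡1 = n*1/n≡1 n

        nv≡1-v : n̂ * v ≡ 1ℚ - v
        nv≡1-v = n*1/[1+n]≡ n

        0≤u : 0ℚ ≤ u
        0≤u = 0≤1/ n

        0<Q : 0ℚ < Q
        0<Q = 0<fromℕ (suc n ℕ.^ M) {{ℕ.m^n≢0 (suc n) M}}

        surplus : fromℕ (suc n) ≡ fromℕ M + (d * n̂ + fromℕ 2)
        surplus = surplus-eq n M 1 1+M≡cn

        P≡ : P ≡ Q * (d * n̂ + 1ℚ)
        P≡ = begin
          P                                        ≡⟨ lemma₁ P (fromℕ (suc M)) Q ⟩
          (P + fromℕ (suc M) * Q) - fromℕ (suc M) * Q ≡⟨ cong₂ (λ x y → x - y * Q) balance 1+M≡cn ⟩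
          (1ℚ + n̂) * Q - c * n̂ * Q                 ≡⟨ lemma₂ c n̂ Q ⟩
          Q * (d * n̂ + 1ℚ)                         ∎
          where
          open ≡-Reasoning
          balance : P + fromℕ (suc M) * Q ≡ (1ℚ + n̂) * Q
          balance = trans (sym (cast-≡ (‵ countFits n (suc M) ⟨+⟩ ‵ suc M ⟨*⟩ ‵ (suc n ℕ.^ M))))
            (trans (cong fromℕ (countFits-formula n (ℕ.s≤s M≤n)))
            (trans (cast-≡ (‵ suc n ⟨*⟩ ‵ (suc n ℕ.^ M))) (cong (_* Q) (fromℕ-suc n))))
          lemma₁ : ∀ P m Q → P ≡ (P + m * Q) - m * Q
          lemma₁ = solve-∀ ℚ-ring
          lemma₂ : ∀ c n Q → (1ℚ + n) * Q - c * n * Q ≡ Q * ((1ℚ - c) * n + 1ℚ)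
          lemma₂ = solve-∀ ℚ-ring

        0<P : 0ℚ < P
        0<P = subst (0ℚ <_) (sym P≡) (0<* 0<Q (<-≤-trans (0<fromℕ 1)
          (subst (1ℚ ≤_) (+-comm 1ℚ (d * n̂)) (x≤x+y (0≤* 0≤d (0≤fromℕ n))))))

        EP≡A : E * P ≡ A
        EP≡A = trans
          (𝔼-PF (suc M) n (firstPower p) (λ π → pref 0 (ℕ.s≤s ℕ.z≤n) π ℕ.^ p) (λ { (_ ∷ _) → refl }))
          (cong fromℕ (trans (sumFits-∷ M (firstPower p))
            (sumFits-cong M (λ σ _ → sumFree-below σ (λ k → suc k ℕ.^ p)))))

        -- `E * (s * i)` is the expectation divided by nᵖ / (p + 1); the factor 2 is the one with
        -- which the trapezoidal identity clears its denominator.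
        tP≡V : E * (s * i) * (fromℕ 2 * P) ≡ V
        tP≡V = trans (lemma E s i P) (cong (fromℕ 2 * s * i *_) EP≡A)
          where
          lemma : ∀ E s i P → E * (s * i) * (fromℕ 2 * P) ≡ fromℕ 2 * s * i * (E * P)
          lemma = solve-∀ ℚ-ring

        main : ℚ
        main = (fromℕ 2 * n̂ + fromℕ 3 * s) * Z + - (fromℕ 2 * s) * Q

        V≈main : ∣ V - main ∣ ≤ K₀ * u * (Q * (r * r))
        V≈main = ≤-trans (subst (λ x → ∣ x - main ∣ ≤ K₀ * u * U)
            (trans (∑-* (PF M n) (fromℕ 2 * s * i) (λ π → fromℕ (powerSum p (lastFree (toList π)))))
              (cong (fromℕ 2 * s * i *_) (∑-PF M n (λ σ → powerSum p (lastFree σ)))))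
            (gap-moments n M≤n (λ σ → fromℕ 2 * s * i * fromℕ (powerSum p (lastFree σ)))
              (fromℕ 2 * n̂ + fromℕ 3 * s) (- (fromℕ 2 * s)) (K₀ * u)
              (powerSum-gap p 1≤p u i 0≤u (0≤1/ (n ℕ.^ p)) nu≡1 (n*1/n≡1 (n ℕ.^ p)))))
          (*-monoˡ (0≤* (0≤fromℕ (powerSumError p)) 0≤u)
            (secondMoment-bound n M M≤n d (fromℕ 2) surplus r 0≤d
              (≤-trans d≤1 (fromℕ-mono-≤ {1} {2} (ℕ.s≤s ℕ.z≤n))) dr≡1 0≤r))

        main≈ : ∣ main - fromℕ 2 * P * (1ℚ + u * κ) ∣ ≤ B * R
        main≈ = subst (λ x → ∣ x ∣ ≤ B * R)
          (sym (trans (cong₂ (λ x y → ((fromℕ 2 * n̂ + fromℕ 3 * s) * x + - (fromℕ 2 * s) * Q) - fromℕ 2 * y * (1ℚ + u * κ))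
              (countFits-ratio n M M≤n d (fromℕ 2) surplus v (n*1/n≡1 (suc n))) P≡)
            (oneCar-expansion n̂ s Q d v u κ nu≡1 nv≡1-v 2dκ≡)))
          (∣*∣-≤ B _ (≤-reflexive (0≤p⇒∣p∣≡p (0≤* (<⇒≤ 0<Q) 0≤u)))
            (∣affine∣-≤ (oneCar-α d s - fromℕ 2 * κ) (- oneCar-α d s) 0ℚ
              0≤u (1/n≤1 n) (0≤1/ (suc n)) (1/n≤1 (suc n))))

        error : ∣ V - fromℕ 2 * P * (1ℚ + u * κ) ∣ ≤ B * K₁
        error = subst (∣ V - fromℕ 2 * P * (1ℚ + u * κ) ∣ ≤_) (lemma K₀ u Q (r * r) R)
          (∣∣-triangle V main (fromℕ 2 * P * (1ℚ + u * κ)) V≈main main≈)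
          where
          lemma : ∀ K u Q x R → K * u * (Q * x) + Q * u * R ≡ Q * u * (K * x + R)
          lemma = solve-∀ ℚ-ring

        Bd≤ : B * d ≤ fromℕ 2 * P * (u * u)
        Bd≤ = subst (B * d ≤_) (sym (begin
          fromℕ 2 * P * (u * u)                         ≡⟨ cong (λ x → fromℕ 2 * x * (u * u)) P≡ ⟩
          fromℕ 2 * (Q * (d * n̂ + 1ℚ)) * (u * u)        ≡⟨ lemma₁ Q d n̂ u ⟩
          Q * u * (fromℕ 2 * (d * (n̂ * u) + u))         ≡⟨ cong (λ x → Q * u * (fromℕ 2 * (d * x + u))) nu≡1 ⟩
          Q * u * (fromℕ 2 * (d * 1ℚ + u))              ≡⟨ lemma₂ Q d u ⟩
          Q * u * d + Q * u * (d + fromℕ 2 * u)         ∎))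
          (x≤x+y (0≤* (0≤* (<⇒≤ 0<Q) 0≤u) (0≤+ 0≤d (0≤* (0≤fromℕ 2) 0≤u))))
          where
          open ≡-Reasoning
          lemma₁ : ∀ Q d n u → fromℕ 2 * (Q * (d * n + 1ℚ)) * (u * u) ≡ Q * u * (fromℕ 2 * (d * (n * u) + u))
          lemma₁ = solve-∀ ℚ-ring
          lemma₂ : ∀ Q d u → Q * u * (fromℕ 2 * (d * 1ℚ + u)) ≡ Q * u * d + Q * u * (d + fromℕ 2 * u)
          lemma₂ = solve-∀ ℚ-ring

      expectation : ∃[ ε ] ∣ ε ∣ ≤ K₁ * r * (+ 1 / n) * (+ 1 / n) ×
        𝔼 (PF (suc M) n) (λ π → fromℕ (pref 0 (ℕ.s≤s ℕ.z≤n) π ℕ.^ p))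
          ≡ (+ (n ℕ.^ p) / suc p) * (1ℚ + (+ 1 / n) * κ + ε)
      expectation = E * (s * i) - (1ℚ + u * κ)
        , quotient-bound (E * (s * i)) V (fromℕ 2 * P) κ u K₁ B d r
            (0<* (0<fromℕ 2) 0<P) tP≡V 0≤K₁ 0≤r dr≡1 Bd≤ error
        , expand-expectation E (+ (n ℕ.^ p) / suc p) (s * i) (1ℚ + u * κ)
            (trans (sym (*-assoc (+ (n ℕ.^ p) / suc p) s i))
              (trans (cong (_* i) (/-*-cancel (n ℕ.^ p) (suc p))) (n*1/n≡1 (n ℕ.^ p))))

  module TwoCar (p q : ℕ) (1≤p : 1 ℕ.≤ p) (1≤q : 1 ℕ.≤ q) where

    κ s₁ s₂ s K₀ R K₁ : ℚ
    κ  = (+ (p ℕ.+ q ℕ.+ 2) / 2) - _÷_ (c * fromℕ (p ℕ.+ q)) d {{1-c≢0 c<1}}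
    s₁ = fromℕ (suc p)
    s₂ = fromℕ (suc q)
    s  = s₁ + s₂
    K₀ = fromℕ 2 * s₂ * fromℕ (powerSumError p) + (fromℕ 2 + fromℕ 2 * s₁) * fromℕ (powerSumError q)
       + fromℕ 4 * s₁ * s₂
    R  = ∣ - twoCar-β d s - fromℕ 4 - fromℕ 4 * (d + 1ℚ) * κ ∣ + ∣ twoCar-β d s ∣ + ∣ - (fromℕ 4 * κ) ∣
    -- `4 s₁ s₂` pays for the deficit and `K₀` for the product of the linearised power sums; both
    -- multiply the same second moment.
    K₁ = (fromℕ 4 * s₁ * s₂ + K₀) * (r * r) + R

    2dκ≡ : fromℕ 2 * (d * κ) ≡ d * s - fromℕ 2 * ((1ℚ - d) * (s - fromℕ 2))
    2dκ≡ = trans (correction-eq c r (+ (p ℕ.+ q ℕ.+ 2) / 2) s (fromℕ (p ℕ.+ q)) dr≡1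
        (trans (/-*-cancel (p ℕ.+ q ℕ.+ 2) 2) (trans (fromℕ-+ (p ℕ.+ q) 2) (sym s≡))))
      (cong (λ x → d * s - fromℕ 2 * ((1ℚ - d) * x))
        (sym (trans (cong (_- fromℕ 2) s≡) (lemma₂ (fromℕ (p ℕ.+ q))))))
      where
      lemma₁ : ∀ x y → (1ℚ + x) + (1ℚ + y) ≡ (x + y) + fromℕ 2
      lemma₁ = solve-∀ ℚ-ring
      lemma₂ : ∀ x → (x + fromℕ 2) - fromℕ 2 ≡ x
      lemma₂ = solve-∀ ℚ-ring
      s≡ : s ≡ fromℕ (p ℕ.+ q) + fromℕ 2
      s≡ = trans (cong₂ _+_ (fromℕ-suc p) (fromℕ-suc q)) (trans (lemma₁ (fromℕ p) (fromℕ q))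
        (cong (_+ fromℕ 2) (sym (fromℕ-+ p q))))

    0≤4s₁s₂ : 0ℚ ≤ fromℕ 4 * s₁ * s₂
    0≤4s₁s₂ = 0≤* (0≤* (0≤fromℕ 4) (0≤fromℕ (suc p))) (0≤fromℕ (suc q))

    0≤4s₁s₂+K₀ : 0ℚ ≤ fromℕ 4 * s₁ * s₂ + K₀
    0≤4s₁s₂+K₀ = 0≤+ 0≤4s₁s₂ (0≤+ (0≤+
      (0≤* (0≤* (0≤fromℕ 2) (0≤fromℕ (suc q))) (0≤fromℕ (powerSumError p)))
      (0≤* (0≤+ (0≤fromℕ 2) (0≤* (0≤fromℕ 2) (0≤fromℕ (suc p)))) (0≤fromℕ (powerSumError q)))) 0≤4s₁s₂)

    0≤K₁ : 0ℚ ≤ K₁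
    0≤K₁ = 0≤+ (0≤* 0≤4s₁s₂+K₀ (0≤* 0≤r 0≤r))
      (0≤+ (0≤+ (0≤∣p∣ (- twoCar-β d s - fromℕ 4 - fromℕ 4 * (d + 1ℚ) * κ)) (0≤∣p∣ (twoCar-β d s)))
        (0≤∣p∣ (- (fromℕ 4 * κ))))

    module _ (n M : ℕ) .{{_ : ℕ.NonZero n}} (2+M≡cn : fromℕ (2 ℕ.+ M) ≡ c * fromℕ n) where

      private
        instance
          n^p≢0 : ℕ.NonZero (n ℕ.^ p)
          n^p≢0 = ℕ.m^n≢0 n p
          n^q≢0 : ℕ.NonZero (n ℕ.^ q)
          n^q≢0 = ℕ.m^n≢0 n q

        M<n : M ℕ.< n
        M<n = ℕ.<-trans (ℕ.<-trans (ℕ.n<1+n M) (ℕ.n<1+n (suc M))) (m<n n (2 ℕ.+ M) 2+M≡cn)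

        M≤n : M ℕ.≤ n
        M≤n = ℕ.<⇒≤ M<n

        X Y : ℕ → ℕ
        X k = suc k ℕ.^ p
        Y k = suc k ℕ.^ q

        n̂ u v i₁ i₂ Q Z U P E A k V : ℚ
        n̂  = fromℕ n
        u  = + 1 / n
        v  = + 1 / suc n
        i₁ = + 1 / (n ℕ.^ p)
        i₂ = + 1 / (n ℕ.^ q)
        Q  = fromℕ (suc n ℕ.^ M)
        Z  = fromℕ (countFits n M)
        U  = fromℕ (doubleResolvent (suc n) M)
        P  = fromℕ (countFits n (2 ℕ.+ M))
        E  = 𝔼 (PF (2 ℕ.+ M) n) (λ π → fromℕ
          (pref 0 (m<n⇒0<n (ℕ.s≤s (ℕ.s≤s ℕ.z≤n))) π ℕ.^ p ℕ.* pref 1 (ℕ.s≤s (ℕ.s≤s ℕ.z≤n)) π ℕ.^ q))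
        A  = fromℕ (sumFits M (λ (σ : List (Fin n)) → pairSum X Y σ))
        k  = fromℕ 4 * s₁ * s₂ * (i₁ * i₂)
        V  = k * A

        a₁ a₂ : List (Fin n) → ℚ
        a₁ σ = fromℕ 2 * s₁ * i₁ * fromℕ (powerSum p (lastFree σ))
        a₂ σ = fromℕ 2 * s₂ * i₂ * fromℕ (powerSum q (lastFree σ))

        nu≡1 : n̂ * u ≡ 1ℚ
        nu≡1 = n*1/n≡1 n

        N₁i₁≡1 : fromℕ (n ℕ.^ p) * i₁ ≡ 1ℚ
        N₁i₁≡1 = n*1/n≡1 (n ℕ.^ p)

        N₂i₂≡1 : fromℕ (n ℕ.^ q) * i₂ ≡ 1ℚ
        N₂i₂≡1 = n*1/n≡1 (n ℕ.^ q)

        0≤u : 0ℚ ≤ u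
        0≤u = 0≤1/ n

        0<Q : 0ℚ < Q
        0<Q = 0<fromℕ (suc n ℕ.^ M) {{ℕ.m^n≢0 (suc n) M}}

        0≤k : 0ℚ ≤ k
        0≤k = 0≤* 0≤4s₁s₂ (0≤* (0≤1/ (n ℕ.^ p)) (0≤1/ (n ℕ.^ q)))

        surplus : fromℕ (suc n) ≡ fromℕ M + (d * n̂ + fromℕ 3)
        surplus = surplus-eq n M 2 2+M≡cn

        P≡ : P ≡ Q * ((1ℚ + n̂) * (d * n̂ + 1ℚ))
        P≡ = begin
          P                                       ≡⟨ lemma₁ P (fromℕ (2 ℕ.+ M)) (fromℕ (suc n) * Q) ⟩
          (P + fromℕ (2 ℕ.+ M) * (fromℕ (suc n) * Q)) - fromℕ (2 ℕ.+ M) * (fromℕ (suc n) * Q)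
                                                  ≡⟨ cong₂ (λ x y → x - y * (fromℕ (suc n) * Q)) balance 2+M≡cn ⟩
          fromℕ (suc n) * (fromℕ (suc n) * Q) - c * n̂ * (fromℕ (suc n) * Q)
                                                  ≡⟨ cong (λ x → x * (x * Q) - c * n̂ * (x * Q)) (fromℕ-suc n) ⟩
          (1ℚ + n̂) * ((1ℚ + n̂) * Q) - c * n̂ * ((1ℚ + n̂) * Q) ≡⟨ lemma₂ c n̂ Q ⟩
          Q * ((1ℚ + n̂) * (d * n̂ + 1ℚ))           ∎
          where
          open ≡-Reasoning
          balance : P + fromℕ (2 ℕ.+ M) * (fromℕ (suc n) * Q) ≡ fromℕ (suc n) * (fromℕ (suc n) * Q)
          balance = trans
            (sym (cast-≡ (‵ countFits n (2 ℕ.+ M) ⟨+⟩ ‵ (2 ℕ.+ M) ⟨*⟩ (‵ suc n ⟨*⟩ ‵ (suc n ℕ.^ M)))))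
            (trans (cong fromℕ (countFits-formula n (ℕ.s≤s M<n)))
              (cast-≡ (‵ suc n ⟨*⟩ (‵ suc n ⟨*⟩ ‵ (suc n ℕ.^ M)))))
          lemma₁ : ∀ P m x → P ≡ (P + m * x) - m * x
          lemma₁ = solve-∀ ℚ-ring
          lemma₂ : ∀ c n Q → (1ℚ + n) * ((1ℚ + n) * Q) - c * n * ((1ℚ + n) * Q)
            ≡ Q * ((1ℚ + n) * ((1ℚ - c) * n + 1ℚ))
          lemma₂ = solve-∀ ℚ-ring

        0<P : 0ℚ < P
        0<P = subst (0ℚ <_) (sym P≡) (0<* 0<Q (0<*
          (<-≤-trans (0<fromℕ 1) (x≤x+y (0≤fromℕ n)))
          (<-≤-trans (0<fromℕ 1) (subst (1ℚ ≤_) (+-comm 1ℚ (d * n̂)) (x≤x+y (0≤* 0≤d (0≤fromℕ n)))))))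

        EP≡A : E * P ≡ A
        EP≡A = trans
          (𝔼-PF (2 ℕ.+ M) n (firstTwoPower p q) (λ π →
              pref 0 (m<n⇒0<n (ℕ.s≤s (ℕ.s≤s ℕ.z≤n))) π ℕ.^ p ℕ.* pref 1 (ℕ.s≤s (ℕ.s≤s ℕ.z≤n)) π ℕ.^ q)
            (λ { (_ ∷ _ ∷ _) → refl }))
          (cong fromℕ (sumFits-pair M (firstTwoPower p q) X Y (λ i j σ → ℕ.*-comm (X (toℕ i)) (Y (toℕ j)))))

        tP≡V : E * (s₁ * s₂ * (i₁ * i₂)) * (fromℕ 4 * P) ≡ V
        tP≡V = trans (lemma E s₁ s₂ (i₁ * i₂) P) (cong (k *_) EP≡A)
          where
          lemma : ∀ E s t i P → E * (s * t * i) * (fromℕ 4 * P) ≡ fromℕ 4 * s * t * i * (E * P)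
          lemma = solve-∀ ℚ-ring

        -- Preferences are at most n, so a lost pair weighs at most nᵖ n^q, which `i₁ * i₂`
        -- normalises to 1; only the number of lost pairs is left.
        pair≈product : ∀ σ → ∣ k * fromℕ (pairSum X Y σ) - a₁ σ * a₂ σ ∣ ≤ fromℕ 4 * s₁ * s₂ * fromℕ (deficit σ)
        pair≈product σ = subst (λ x → ∣ x ∣ ≤ fromℕ 4 * s₁ * s₂ * fromℕ (deficit σ))
          (lemma₁ s₁ s₂ i₁ i₂ (fromℕ (pairSum X Y σ)) (fromℕ S₁) (fromℕ S₂))
          (subst (∣ k * (fromℕ (pairSum X Y σ) - fromℕ S₁ * fromℕ S₂) ∣ ≤_)
            (trans (lemma₂ (fromℕ 4 * s₁ * s₂) i₁ i₂ (fromℕ (n ℕ.^ p)) (fromℕ (n ℕ.^ q)) (fromℕ (deficit σ)))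
              (trans (cong₂ (λ x y → fromℕ 4 * s₁ * s₂ * (x * y * fromℕ (deficit σ))) N₁i₁≡1 N₂i₂≡1)
                (lemma₃ (fromℕ 4 * s₁ * s₂) (fromℕ (deficit σ)))))
            (∣*∣-≤ k (fromℕ (pairSum X Y σ) - fromℕ S₁ * fromℕ S₂) (≤-reflexive (0≤p⇒∣p∣≡p 0≤k))
              (∣-∣-≤
                (≤-trans (subst (fromℕ (pairSum X Y σ) ≤_) (cast-≡ (‵ S₁ ⟨*⟩ ‵ S₂)) (fromℕ-mono-≤ (pairSum-≤ X Y σ)))
                  (x≤x+y (0≤* (0≤* (0≤fromℕ (n ℕ.^ q)) (0≤fromℕ (n ℕ.^ p))) (0≤fromℕ (deficit σ)))))
                (subst₂ _≤_ (cast-≡ (‵ S₁ ⟨*⟩ ‵ S₂))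
                  (cast-≡ (‵ pairSum X Y σ ⟨+⟩ ‵ (n ℕ.^ q) ⟨*⟩ ‵ (n ℕ.^ p) ⟨*⟩ ‵ deficit σ))
                  (fromℕ-mono-≤ (pairSum-≥ X Y (n ℕ.^ p) (n ℕ.^ q) σ (ℕ.^-monoˡ-≤ p) (ℕ.^-monoˡ-≤ q)))))))
          where
          S₁ = powerSum p (lastFree σ)
          S₂ = powerSum q (lastFree σ)
          lemma₁ : ∀ s t i j x a b → fromℕ 4 * s * t * (i * j) * (x - a * b)
            ≡ fromℕ 4 * s * t * (i * j) * x - (fromℕ 2 * s * i * a) * (fromℕ 2 * t * j * b)
          lemma₁ = solve-∀ ℚ-ring
          lemma₂ : ∀ s i j a b x → s * (i * j) * (b * a * x) ≡ s * (a * i * (b * j) * x)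
          lemma₂ = solve-∀ ℚ-ring
          lemma₃ : ∀ s x → s * (1ℚ * 1ℚ * x) ≡ s * x
          lemma₃ = solve-∀ ℚ-ring

        product : ℚ
        product = ∑ (PF M n) (λ π → a₁ (toList π) * a₂ (toList π))

        V≈product : ∣ V - product ∣ ≤ fromℕ 4 * s₁ * s₂ * U
        V≈product = subst₂ (λ x y → ∣ x - product ∣ ≤ y)
          (trans (∑-* (PF M n) k (λ π → fromℕ (pairSum X Y (toList π))))
            (cong (k *_) (∑-PF M n (pairSum X Y))))
          (trans (∑-* (PF M n) (fromℕ 4 * s₁ * s₂) (λ π → fromℕ (deficit (toList π))))
            (cong (fromℕ 4 * s₁ * s₂ *_) (trans (∑-PF M n deficit) (cong fromℕ (sumFits-deficit n M M<n)))))
          (∑-approx (PF M n) (λ π → k * fromℕ (pairSum X Y (toList π)))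
            (λ π → a₁ (toList π) * a₂ (toList π))
            (λ π → fromℕ 4 * s₁ * s₂ * fromℕ (deficit (toList π))) (pair≈product ∘ toList))

        main : ℚ
        main = (fromℕ 4 * n̂ * n̂ + fromℕ 6 * n̂ * s) * Z + - (fromℕ 4 * n̂ * s) * Q

        ∣a₂∣≤ : ∀ σ → ∣ a₂ σ ∣ ≤ fromℕ 2 * s₂ * n̂
        ∣a₂∣≤ σ = subst₂ _≤_
          (sym (0≤p⇒∣p∣≡p (0≤* 0≤2s₂i₂ (0≤fromℕ S₂))))
          (trans (lemma₁ (fromℕ 2 * s₂) i₂ (fromℕ (n ℕ.^ q)) n̂)
            (trans (cong (λ x → fromℕ 2 * s₂ * (x * n̂)) N₂i₂≡1) (cong (fromℕ 2 * s₂ *_) (*-identityˡ n̂))))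
          (*-monoˡ 0≤2s₂i₂ (subst (fromℕ S₂ ≤_) (cast-≡ (‵ (n ℕ.^ q) ⟨*⟩ ‵ n))
            (fromℕ-mono-≤ (ℕ.≤-trans
              (below-bound (lastFree σ) Y (n ℕ.^ q) (λ k<f → ℕ.^-monoˡ-≤ q (ℕ.<-≤-trans k<f (lastFree≤n σ))))
              (ℕ.*-monoʳ-≤ (n ℕ.^ q) (lastFree≤n σ))))))
          where
          S₂ = powerSum q (lastFree σ)
          0≤2s₂i₂ : 0ℚ ≤ fromℕ 2 * s₂ * i₂
          0≤2s₂i₂ = 0≤* (0≤* (0≤fromℕ 2) (0≤fromℕ (suc q))) (0≤1/ (n ℕ.^ q))
          lemma₁ : ∀ s i N n → s * i * (N * n) ≡ s * (N * i * n)
          lemma₁ = solve-∀ ℚ-ring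

        product≈main : ∣ product - main ∣ ≤ K₀ * U
        product≈main = gap-moments n M≤n (λ σ → a₁ σ * a₂ σ)
          (fromℕ 4 * n̂ * n̂ + fromℕ 6 * n̂ * s) (- (fromℕ 4 * n̂ * s)) K₀
          (λ σ → product-approx (a₁ σ) (a₂ σ) s₁ s₂ n u (fromℕ (powerSumError p)) (fromℕ (powerSumError q)) (gap σ)
            (0≤fromℕ (suc p)) (0≤fromℕ (suc q)) 0≤u (0≤fromℕ (powerSumError p)) (0≤fromℕ (powerSumError q))
            (ℕ.>-nonZero⁻¹ n) (ℕ.m<n⇒0<n∸m (ℕ.s≤s (lastFree≤n σ))) (ℕ.m∸n≤m (suc n) (lastFree σ)) nu≡1
            (powerSum-gap p 1≤p u i₁ 0≤u (0≤1/ (n ℕ.^ p)) nu≡1 N₁i₁≡1 σ)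
            (powerSum-gap q 1≤q u i₂ 0≤u (0≤1/ (n ℕ.^ q)) nu≡1 N₂i₂≡1 σ)
            (∣a₂∣≤ σ))

        V≈main : ∣ V - main ∣ ≤ (fromℕ 4 * s₁ * s₂ + K₀) * (Q * (r * r))
        V≈main = ≤-trans
          (subst (∣ V - main ∣ ≤_) (sym (*-distribʳ-+ U (fromℕ 4 * s₁ * s₂) K₀))
            (∣∣-triangle V product main V≈product product≈main))
          (*-monoˡ 0≤4s₁s₂+K₀ (secondMoment-bound n M M≤n d (fromℕ 3) surplus r 0≤d
            (≤-trans d≤1 (fromℕ-mono-≤ {1} {3} (ℕ.s≤s ℕ.z≤n))) dr≡1 0≤r))

        main≈ : ∣ main - fromℕ 4 * P * (1ℚ + u * κ) ∣ ≤ Q * R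
        main≈ = subst (λ x → ∣ x ∣ ≤ Q * R)
          (sym (trans (cong₂ (λ x y → ((fromℕ 4 * n̂ * n̂ + fromℕ 6 * n̂ * s) * x + - (fromℕ 4 * n̂ * s) * Q)
                - fromℕ 4 * y * (1ℚ + u * κ))
              (countFits-ratio n M M≤n d (fromℕ 3) surplus v (n*1/n≡1 (suc n))) P≡)
            (twoCar-expansion n̂ s Q d v u κ nu≡1 (n*1/[1+n]≡ n) 2dκ≡)))
          (∣*∣-≤ Q _ (≤-reflexive (0≤p⇒∣p∣≡p (<⇒≤ 0<Q)))
            (∣affine∣-≤ (- twoCar-β d s - fromℕ 4 - fromℕ 4 * (d + 1ℚ) * κ) (twoCar-β d s) (- (fromℕ 4 * κ))
              0≤u (1/n≤1 n) (0≤1/ (suc n)) (1/n≤1 (suc n))))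

        error : ∣ V - fromℕ 4 * P * (1ℚ + u * κ) ∣ ≤ Q * K₁
        error = subst (∣ V - fromℕ 4 * P * (1ℚ + u * κ) ∣ ≤_) (lemma (fromℕ 4 * s₁ * s₂ + K₀) Q (r * r) R)
          (∣∣-triangle V main (fromℕ 4 * P * (1ℚ + u * κ)) V≈main main≈)
          where
          lemma : ∀ K Q x R → K * (Q * x) + Q * R ≡ Q * (K * x + R)
          lemma = solve-∀ ℚ-ring

        Qd≤ : Q * d ≤ fromℕ 4 * P * (u * u)
        Qd≤ = subst (Q * d ≤_) (sym (begin
          fromℕ 4 * P * (u * u)
            ≡⟨ cong (λ x → fromℕ 4 * x * (u * u)) P≡ ⟩
          fromℕ 4 * (Q * ((1ℚ + n̂) * (d * n̂ + 1ℚ))) * (u * u)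
            ≡⟨ lemma₁ Q d n̂ u ⟩
          fromℕ 4 * Q * ((u + n̂ * u) * (d * (n̂ * u) + u))
            ≡⟨ cong (λ x → fromℕ 4 * Q * ((u + x) * (d * x + u))) nu≡1 ⟩
          fromℕ 4 * Q * ((u + 1ℚ) * (d * 1ℚ + u))
            ≡⟨ lemma₂ Q d u ⟩
          Q * d + Q * (fromℕ 3 * d + fromℕ 4 * (u * (d + u + 1ℚ))) ∎))
          (x≤x+y (0≤* (<⇒≤ 0<Q) (0≤+ (0≤* (0≤fromℕ 3) 0≤d)
            (0≤* (0≤fromℕ 4) (0≤* 0≤u (0≤+ (0≤+ 0≤d 0≤u) (0≤fromℕ 1)))))))
          where
          open ≡-Reasoning
          lemma₁ : ∀ Q d n u → fromℕ 4 * (Q * ((1ℚ + n) * (d * n + 1ℚ))) * (u * u)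
            ≡ fromℕ 4 * Q * ((u + n * u) * (d * (n * u) + u))
          lemma₁ = solve-∀ ℚ-ring
          lemma₂ : ∀ Q d u → fromℕ 4 * Q * ((u + 1ℚ) * (d * 1ℚ + u))
            ≡ Q * d + Q * (fromℕ 3 * d + fromℕ 4 * (u * (d + u + 1ℚ)))
          lemma₂ = solve-∀ ℚ-ring

        C : ℚ
        C = + (n ℕ.^ (p ℕ.+ q)) / (suc p ℕ.* suc q)

        Cx≡1 : C * (s₁ * s₂ * (i₁ * i₂)) ≡ 1ℚ
        Cx≡1 = begin
          C * (s₁ * s₂ * (i₁ * i₂))             ≡⟨ sym (*-assoc C (s₁ * s₂) (i₁ * i₂)) ⟩
          C * (s₁ * s₂) * (i₁ * i₂)             ≡⟨ cong (λ x → C * x * (i₁ * i₂)) (sym (fromℕ-* (suc p) (suc q))) ⟩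
          C * fromℕ (suc p ℕ.* suc q) * (i₁ * i₂)
            ≡⟨ cong (_* (i₁ * i₂)) (/-*-cancel (n ℕ.^ (p ℕ.+ q)) (suc p ℕ.* suc q)) ⟩
          fromℕ (n ℕ.^ (p ℕ.+ q)) * (i₁ * i₂)
            ≡⟨ cong (_* (i₁ * i₂)) (trans (cong fromℕ (ℕ.^-distribˡ-+-* n p q)) (fromℕ-* (n ℕ.^ p) (n ℕ.^ q))) ⟩
          fromℕ (n ℕ.^ p) * fromℕ (n ℕ.^ q) * (i₁ * i₂)
            ≡⟨ lemma (fromℕ (n ℕ.^ p)) (fromℕ (n ℕ.^ q)) i₁ i₂ ⟩
          (fromℕ (n ℕ.^ p) * i₁) * (fromℕ (n ℕ.^ q) * i₂)
            ≡⟨ cong₂ _*_ N₁i₁≡1 N₂i₂≡1 ⟩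
          1ℚ * 1ℚ ≡⟨ *-identityˡ 1ℚ ⟩
          1ℚ ∎
          where
          open ≡-Reasoning
          lemma : ∀ a b i j → a * b * (i * j) ≡ (a * i) * (b * j)
          lemma = solve-∀ ℚ-ring

      expectation : ∃[ ε ] ∣ ε ∣ ≤ K₁ * r * (+ 1 / n) * (+ 1 / n) ×
        𝔼 (PF (2 ℕ.+ M) n) (λ π → fromℕ
          (pref 0 (m<n⇒0<n (ℕ.s≤s (ℕ.s≤s ℕ.z≤n))) π ℕ.^ p ℕ.* pref 1 (ℕ.s≤s (ℕ.s≤s ℕ.z≤n)) π ℕ.^ q))
          ≡ (+ (n ℕ.^ (p ℕ.+ q)) / (suc p ℕ.* suc q)) * (1ℚ + (+ 1 / n) * κ + ε)
      expectation = E * (s₁ * s₂ * (i₁ * i₂)) - (1ℚ + u * κ)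
        , quotient-bound (E * (s₁ * s₂ * (i₁ * i₂))) V (fromℕ 4 * P) κ u K₁ Q d r
            (0<* (0<fromℕ 4) 0<P) tP≡V 0≤K₁ 0≤r dr≡1 Qd≤ error
        , expand-expectation E C (s₁ * s₂ * (i₁ * i₂)) (1ℚ + u * κ) Cx≡1

theorem3p1 : (p q : ℕ) → 1 ℕ.≤ p → 1 ℕ.≤ q →
    (c : ℚ) → 0ℚ < c → (c<1 : c < 1ℚ) →
    (∃[ K ] ∃[ N ] ((n m : ℕ) .{{_ : ℕ.NonZero n}} →
    N ℕ.≤ n → fromℕ m ≡ c * fromℕ n →
    Σ[ 0<m ∈ 0 ℕ.< m ] ∃[ ε ]
    ∣ ε ∣ ≤ K * (+ 1 / n) * (+ 1 / n) ×
    𝔼 (PF m n) (λ π → fromℕ (pref 0 0<m π ℕ.^ p))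
    ≡ (+ (n ℕ.^ p) / suc p)
    * (1ℚ
    + (+ 1 / n) * ((+ suc p / 2) - _÷_ (c * fromℕ p) (1ℚ - c) {{1-c≢0 c<1}})
    + ε)))
    ×
    (∃[ K ] ∃[ N ] ((n m : ℕ) .{{_ : ℕ.NonZero n}} →
    N ℕ.≤ n → fromℕ m ≡ c * fromℕ n →
    Σ[ 1<m ∈ 1 ℕ.< m ] ∃[ ε ]
    ∣ ε ∣ ≤ K * (+ 1 / n) * (+ 1 / n) ×
    𝔼 (PF m n) (λ π → fromℕ (pref 0 (m<n⇒0<n 1<m) π ℕ.^ p ℕ.* pref 1 1<m π ℕ.^ q))
    ≡ (+ (n ℕ.^ (p ℕ.+ q)) / (suc p ℕ.* suc q))
    * (1ℚ
    + (+ 1 / n) * ((+ (p ℕ.+ q ℕ.+ 2) / 2) - _÷_ (c * fromℕ (p ℕ.+ q)) (1ℚ - c) {{1-c≢0 c<1}})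
    + ε)))
-- One car exists as soon as m = c n is positive, hence the threshold 0. Two cars require c n > 1; n
-- ≥ 2 b with c b ≥ 1 ensures even c n ≥ 2.
theorem3p1 p q 1≤p 1≤q c 0<c c<1 = (K¹ , 0 , one) , (K² , 2 ℕ.* b ,
  (λ n m 2b≤n m≡cn → two n m (1<m n m 2b≤n m≡cn) m≡cn))
  where
  module O = OneCar c 0<c c<1 p 1≤p
  module W = TwoCar c 0<c c<1 p q 1≤p 1≤q
  K¹ K² : ℚ
  K¹ = O.K₁ * (1/ (1ℚ - c)) {{1-c≢0 c<1}}
  K² = W.K₁ * (1/ (1ℚ - c)) {{1-c≢0 c<1}}
  arch : ∃[ b ] 1ℚ ≤ c * fromℕ b
  arch = archimedean c (positive 0<c)
  b : ℕ
  b = proj₁ arch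
  one : (n m : ℕ) .{{_ : ℕ.NonZero n}} → 0 ℕ.≤ n → fromℕ m ≡ c * fromℕ n →
    Σ[ 0<m ∈ 0 ℕ.< m ] ∃[ ε ] ∣ ε ∣ ≤ K¹ * (+ 1 / n) * (+ 1 / n) ×
    𝔼 (PF m n) (λ π → fromℕ (pref 0 0<m π ℕ.^ p)) ≡ (+ (n ℕ.^ p) / suc p) * (1ℚ + (+ 1 / n) * O.κ + ε)
  one n zero    _ m≡cn = contradiction (subst (0ℚ <_) (sym m≡cn) (0<* 0<c (0<fromℕ n))) (<-irrefl refl)
  one n (suc M) _ m≡cn = ℕ.s≤s ℕ.z≤n , O.expectation n M m≡cn
  1<m : ∀ n m → 2 ℕ.* b ℕ.≤ n → fromℕ m ≡ c * fromℕ n → 1 ℕ.< m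
  1<m n m 2b≤n m≡cn = fromℕ-cancel-< (begin-strict
    fromℕ 1                    <⟨ fromℕ-mono-< {1} {2} (ℕ.n<1+n 1) ⟩
    fromℕ 2                    ≡⟨ sym (*-identityʳ (fromℕ 2)) ⟩
    fromℕ 2 * 1ℚ               ≤⟨ *-monoˡ (0≤fromℕ 2) (proj₂ arch) ⟩
    fromℕ 2 * (c * fromℕ b)    ≡⟨ lemma c (fromℕ b) ⟩
    c * (fromℕ 2 * fromℕ b)    ≡⟨ cong (c *_) (sym (fromℕ-* 2 b)) ⟩
    c * fromℕ (2 ℕ.* b)        ≤⟨ *-monoˡ (<⇒≤ 0<c) (fromℕ-mono-≤ 2b≤n) ⟩
    c * fromℕ n                ≡⟨ sym m≡cn ⟩
    fromℕ m                    ∎)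
    where
    open ≤-Reasoning
    lemma : ∀ c b → fromℕ 2 * (c * b) ≡ c * (fromℕ 2 * b)
    lemma = solve-∀ ℚ-ring
  two : (n m : ℕ) .{{_ : ℕ.NonZero n}} → 1 ℕ.< m → fromℕ m ≡ c * fromℕ n →
    Σ[ 1<m ∈ 1 ℕ.< m ] ∃[ ε ] ∣ ε ∣ ≤ K² * (+ 1 / n) * (+ 1 / n) ×
    𝔼 (PF m n) (λ π → fromℕ (pref 0 (m<n⇒0<n 1<m) π ℕ.^ p ℕ.* pref 1 1<m π ℕ.^ q))
      ≡ (+ (n ℕ.^ (p ℕ.+ q)) / (suc p ℕ.* suc q)) * (1ℚ + (+ 1 / n) * W.κ + ε)
  two n (suc (suc M)) (ℕ.s≤s (ℕ.s≤s ℕ.z≤n)) m≡cn = ℕ.s≤s (ℕ.s≤s ℕ.z≤n) , W.expectation n M m≡cn
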